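{- Let $B$ be the bull. Then $rb(K_5,B)=6$ and $rb(K_n,B) = n+2$ for all $n \geq 6$.
   Context: The bull $B$ is the unique graph with $5$ vertices and degree sequence $(1,1,2,3,3)$ (a triangle with pendant edges attached at two distinct vertices). For a graph $H$ and an integer $n$, the rainbow number $rb(K_n,H)$ is the minimum number $m$ such that every edge-colouring of $K_n$ using at least $m$ colours contains a rainbow copy of $H$, i.e. a subgraph isomorphic to $H$ whose edges all have distinct colours. -}

module Defs where

open import Data.Nat using (ℕ; _≤_; _<_)
open import Data.Fin using (Fin; toℕ) renaming (_<_ to _<ᶠ_)
open import Data.Fin.Patterns using (0F; 1F; 2F; 3F; 4F)
open import Data.Product using (Σ; _×_; _,_; proj₁; proj₂)
open import Relation.Binary.PropositionalEquality using (_≡_)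
open import Relation.Nullary using (¬_)
open import Function.Definitions using (Injective)

-- An edge-colouring of the complete graph K_n with colours in ℕ:
-- a symmetric function on pairs of vertices (values on the diagonal are irrelevant).
record Colouring (n : ℕ) : Set where
  field
    col  : Fin n → Fin n → ℕ
    symm : ∀ i j → col i j ≡ col j i
open Colouring public

Edge : ℕ → Set
Edge n = Σ (Fin n × Fin n) λ p → proj₁ p <ᶠ proj₂ p

edgeColour : ∀ {n} → Colouring n → Edge n → ℕ
edgeColour c ((i , j) , _) = col c i j

UsesAtLeast : ∀ {n} → ℕ → Colouring n → Set
UsesAtLeast m c = Σ (Fin m → Edge _) λ f → Injective _≡_ _≡_ (λ k → edgeColour c (f k))

-- The bull B on vertex set {0,…,4}: triangle 0-1-2, pendant edges 0-3 and 1-4.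
-- Degree sequence (1,1,2,3,3).
bullEdge : Fin 5 → Fin 5 × Fin 5
bullEdge 0F = 0F , 1F
bullEdge 1F = 1F , 2F
bullEdge 2F = 0F , 2F
bullEdge 3F = 0F , 3F
bullEdge 4F = 1F , 4F

RainbowBull : ∀ {n} → Colouring n → Set
RainbowBull {n} c =
  Σ (Fin 5 → Fin n) λ φ →
    Injective _≡_ _≡_ φ ×
    Injective _≡_ _≡_ (λ e → col c (φ (proj₁ (bullEdge e))) (φ (proj₂ (bullEdge e))))

Forces : ℕ → ℕ → Set
Forces n m = (c : Colouring n) → UsesAtLeast m c → RainbowBull c

RbBull≡ : ℕ → ℕ → Set
RbBull≡ n m = Forces n m × (∀ k → Forces n k → m ≤ k)

{-# OPTIONS --safe #-}
module Submission where

-- Lower bound: partition the vertices into triangles and 4-cycles (for n = 5: a 4-cycle and a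
-- point), give the cycle edges distinct colours and all other edges one further colour. A
-- rainbow bull has at most one edge of that colour. Since cycle edges give degree at most 2,
-- it is the edge joining the two vertices of degree 3, and what remains is a path on five
-- vertices, too long for a 4-cycle.
--
-- Upper bound: in a colouring without rainbow bull take a minimal vertex set V with too many
-- colours. By minimality the colours lost when a set R ⊆ V is deleted are more than |R| for
-- |R| = 1, 3, 4. In particular each vertex v has two private colours, on edges vp and vq say,
-- and vpq is a rainbow triangle. If V contains five colours on a diamond D, then all edges
-- meeting D have colours of D. So the triangle vpq at some v outside D shares no colour with D,
-- and a further colour lost with vpq completes a rainbow bull whose other pendant edge goes to D.
-- If there is no diamond, a fourth colour lost with a rainbow triangle abd appears on an edge ax,
-- say. Then bull and diamond avoidance force ab, bd to be private at b, and ad, bd at d, and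
-- every edge from b outside the triangle has colour ab or ax. If ax never appears on such an
-- edge, nor on one from d, a triangle at a together with b and d gives a rainbow bull. Otherwise
-- all edges leaving a have colour ax, which is lost with abd; the same analysis of a triangle
-- xpq shows that ax is also lost with xpq, which is absurd as a has further neighbours.

open import Defs
open import Data.Nat using (ℕ; zero; suc; _≤_; _<_; _+_; s≤s; z≤n)
import Data.Nat.Properties as ℕ
open import Data.Nat.Induction using (<-rec)
open import Data.Fin using (Fin; toℕ; zero; suc; join; splitAt; _↑ˡ_; _↑ʳ_; inject≤)
open import Data.Fin.Patterns
import Data.Fin.Properties as Fin
open import Data.List using (List; []; _∷_; _++_; map; length; lookup; filter; allFin)
open import Data.List.Properties using (length-++; filter-notAll; length-tabulate)
open import Data.List.Relation.Unary.All using (All; []; _∷_)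
import Data.List.Relation.Unary.All as All
open import Data.List.Relation.Unary.All.Properties using (¬Any⇒All¬; ¬All⇒Any¬; all-filter; tabulate⁺)
open import Data.List.Relation.Unary.Any using (Any; here; there; index)
open import Data.List.Relation.Unary.Any.Properties using (lookup-index)
import Data.List.Relation.Unary.Any as Any
open import Data.List.Relation.Unary.AllPairs using ([]; _∷_)
open import Data.List.Relation.Unary.Unique.Propositional using (Unique)
open import Data.List.Relation.Unary.Unique.DecPropositional using (unique?)
import Data.List.Relation.Unary.Unique.Propositional.Properties as Unique
open import Data.List.Membership.Propositional using (_∈_; _∉_; find; lose)
open import Data.List.Membership.Propositional.Properties
  using (∈-lookup; ∈-filter⁺; ∈-filter⁻; ∈-++⁺ˡ; ∈-++⁺ʳ; ∈-++⁻; ∈-map⁺; ∈-allFin)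
open import Data.List.Relation.Binary.Subset.Propositional using (_⊆_)
import Data.List.Membership.DecPropositional as DecMembership
open import Data.Product using (Σ; ∃; ∃₂; _×_; _,_; proj₁; proj₂)
open import Data.Sum using (_⊎_; inj₁; inj₂; [_,_]′)
import Data.Sum as Sum
open import Data.Sum.Properties using (inj₁-injective; inj₂-injective)
open import Function using (_∘_; id)
open import Function.Definitions using (Injective)
open import Relation.Binary.Definitions using (DecidableEquality; tri<; tri≈; tri>)
open import Relation.Binary.PropositionalEquality
open import Relation.Nullary using (¬_; Dec; yes; no; contradiction; ¬?; _×-dec_)
open import Relation.Nullary.Decidable using (map′; decidable-stable; from-yes)

-- Repetition-free lists and counting

module _ {A : Set} where

  ∉₁ : ∀ {y p : A} → y ≢ p → y ∉ p ∷ []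
  ∉₁ y≢p (here e) = y≢p e

  ∉₃ : ∀ {y p q r : A} → y ≢ p → y ≢ q → y ≢ r → y ∉ p ∷ q ∷ r ∷ []
  ∉₃ y≢p y≢q y≢r (here e)                 = y≢p e
  ∉₃ y≢p y≢q y≢r (there (here e))         = y≢q e
  ∉₃ y≢p y≢q y≢r (there (there (here e))) = y≢r e

  swap₁₂-∈ : ∀ {p q r : A} → q ∷ p ∷ r ∷ [] ⊆ p ∷ q ∷ r ∷ []
  swap₁₂-∈ (here e)                 = there (here e)
  swap₁₂-∈ (there (here e))         = here e
  swap₁₂-∈ (there (there (here e))) = there (there (here e))

  swap₂₃-∈ : ∀ {p q r : A} → p ∷ r ∷ q ∷ [] ⊆ p ∷ q ∷ r ∷ []
  swap₂₃-∈ (here e)                 = here e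
  swap₂₃-∈ (there (here e))         = there (there (here e))
  swap₂₃-∈ (there (there (here e))) = there (here e)

  list-⊆ : ∀ {xs ys : List A} → All (_∈ ys) xs → xs ⊆ ys
  list-⊆ ps = All.lookup ps

  cons-unique : ∀ {x : A} {xs} → x ∉ xs → Unique xs → Unique (x ∷ xs)
  cons-unique x∉ u = ¬Any⇒All¬ _ x∉ ∷ u

  lookup-injective : ∀ {xs : List A} → Unique xs → ∀ {i j} → lookup xs i ≡ lookup xs j → i ≡ j
  lookup-injective (_ ∷ _)  {zero}  {zero}  _ = refl
  lookup-injective (p ∷ _)  {zero}  {suc j} e = contradiction e (All.lookup p (∈-lookup j))
  lookup-injective (p ∷ _)  {suc i} {zero}  e = contradiction (sym e) (All.lookup p (∈-lookup i))
  lookup-injective (_ ∷ u)  {suc i} {suc j} e = cong suc (lookup-injective u e)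

  unique-⊆⇒length≤ : ∀ {xs ys : List A} → Unique xs → xs ⊆ ys → length xs ≤ length ys
  unique-⊆⇒length≤ {xs} {ys} u s = Fin.injective⇒≤ {f = f} inj
    where
    f : Fin (length xs) → Fin (length ys)
    f i = index (s (∈-lookup i))
    inj : Injective _≡_ _≡_ f
    inj {i} {j} e = lookup-injective u
      (trans (lookup-index (s (∈-lookup i)))
        (trans (cong (lookup ys) e) (sym (lookup-index (s (∈-lookup j))))))

  module _ (_≟_ : DecidableEquality A) where
    open DecMembership _≟_ using (_∈?_)

    pigeonhole : ∀ {xs} ys → Unique xs → length ys < length xs → ∃ λ x → x ∈ xs × x ∉ ys
    pigeonhole {xs} ys u lt with All.all? (_∈? ys) xs
    ... | yes p = contradiction (unique-⊆⇒length≤ u (All.lookup p)) (ℕ.<⇒≱ lt)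
    ... | no ¬p = find (¬All⇒Any¬ (_∈? ys) xs ¬p)

    -- A repeated entry of `E` could be dropped, leaving a list shorter than `L` that still covers
    -- it. Applied to the colours of a few edges: if enough colours occur on them, these edges form
    -- a rainbow graph.
    covering-unique : ∀ {L} E → Unique L → L ⊆ E → length E ≤ length L → Unique E
    covering-unique []      _ _ _ = []
    covering-unique {L} (x ∷ E) u s le = cons-unique x∉E
      (covering-unique E (Unique.filter⁺ (¬? ∘ (_≟ x)) u) L′⊆E
        (ℕ.≤-pred (ℕ.≤-trans le (unique-⊆⇒length≤ {ys = x ∷ L′} u L⊆x∷L′))))
      where
      L′ = filter (¬? ∘ (_≟ x)) L
      x∉E : x ∉ E
      x∉E x∈E = ℕ.<⇒≱ le (unique-⊆⇒length≤ u λ p → absorb (s p))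
        where
        absorb : ∀ {y} → y ∈ x ∷ E → y ∈ E
        absorb (here refl) = x∈E
        absorb (there p)   = p
      L′⊆E : L′ ⊆ E
      L′⊆E p with ∈-filter⁻ (¬? ∘ (_≟ x)) {xs = L} p
      ... | q , y≢x with s q
      ... | here y≡x = contradiction y≡x y≢x
      ... | there r  = r
      L⊆x∷L′ : L ⊆ x ∷ L′
      L⊆x∷L′ {y} p with y ≟ x
      ... | yes y≡x = here y≡x
      ... | no  y≢x = there (∈-filter⁺ (¬? ∘ (_≟ x)) p y≢x)

-- The bound on the number of colours on k vertices of a bull-free colouring of K_n, n ≥ 5;
-- already for k = 4 it uses that there is a fifth vertex.
maxColours : ℕ → ℕ
maxColours 0 = 0
maxColours 1 = 0
maxColours 2 = 1
maxColours 3 = 3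
maxColours 4 = 5
maxColours 5 = 5
maxColours (suc (suc (suc (suc (suc (suc m)))))) = 7 + m

-- Together with `gain₃` and `gain₄`: in a minimal counterexample on `6 + m` vertices, deleting 1, 3
-- or 4 vertices loses more than that many colours. From 4 to 5 vertices the bound does not grow, so
-- five vertices are treated apart.
gain₁ : ∀ m → 1 + maxColours (5 + m) ≤ maxColours (6 + m)
gain₁ 0       = ℕ.m≤m+n 6 1
gain₁ (suc m) = ℕ.≤-refl

gain₃ : ∀ m → 3 + maxColours (3 + m) ≤ maxColours (6 + m)
gain₃ 0                   = ℕ.m≤m+n 6 1
gain₃ 1                   = ℕ.≤-refl
gain₃ 2                   = ℕ.m≤m+n 8 1
gain₃ (suc (suc (suc m))) = ℕ.≤-refl

gain₄ : ∀ m → 4 + maxColours (2 + m) ≤ maxColours (6 + m)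
gain₄ 0                         = ℕ.m≤m+n 5 2
gain₄ 1                         = ℕ.m≤m+n 7 1
gain₄ 2                         = ℕ.≤-refl
gain₄ 3                         = ℕ.m≤m+n 9 1
gain₄ (suc (suc (suc (suc m)))) = ℕ.≤-refl

open DecMembership ℕ._≟_ using () renaming (_∈?_ to _∈ℕ?_)

-- Rainbow triangles, diamonds and occurring colours

module _ {n} (c : Colouring n) where

  open DecMembership (Fin._≟_ {n}) using () renaming (_∈?_ to _∈F?_)

  private
    K = col c
    K-sym = symm c

  -- The pendant vertices and edges come first, so that they can be consed onto a rainbow triangle.
  -- The one permutation `π` translates both the vertices and the edges into the numbering of
  -- `bullEdge`.
  bull : ∀ {a b d x y} → Unique (y ∷ x ∷ a ∷ b ∷ d ∷ []) →
         Unique (K b y ∷ K a x ∷ K a b ∷ K b d ∷ K a d ∷ []) → RainbowBull c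
  bull {a} {b} {d} {x} {y} uv uc = φ , φ-injective , e-injective
    where
    π π⁻¹ : Fin 5 → Fin 5
    π 0F = 2F
    π 1F = 3F
    π 2F = 4F
    π 3F = 1F
    π 4F = 0F
    π⁻¹ 2F = 0F
    π⁻¹ 3F = 1F
    π⁻¹ 4F = 2F
    π⁻¹ 1F = 3F
    π⁻¹ 0F = 4F
    π⁻¹∘π : ∀ i → π⁻¹ (π i) ≡ i
    π⁻¹∘π 0F = refl
    π⁻¹∘π 1F = refl
    π⁻¹∘π 2F = refl
    π⁻¹∘π 3F = refl
    π⁻¹∘π 4F = refl
    π-injective : ∀ {i j} → π i ≡ π j → i ≡ j
    π-injective {i} {j} e = trans (sym (π⁻¹∘π i)) (trans (cong π⁻¹ e) (π⁻¹∘π j))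
    φ : Fin 5 → Fin n
    φ = lookup (y ∷ x ∷ a ∷ b ∷ d ∷ []) ∘ π
    φ-injective : Injective _≡_ _≡_ φ
    φ-injective = π-injective ∘ lookup-injective uv
    colours : List ℕ
    colours = K b y ∷ K a x ∷ K a b ∷ K b d ∷ K a d ∷ []
    e : Fin 5 → ℕ
    e i = K (φ (proj₁ (bullEdge i))) (φ (proj₂ (bullEdge i)))
    e-lookup : ∀ i → e i ≡ lookup colours (π i)
    e-lookup 0F = refl
    e-lookup 1F = refl
    e-lookup 2F = refl
    e-lookup 3F = refl
    e-lookup 4F = refl
    e-injective : Injective _≡_ _≡_ e
    e-injective {i} {j} p =
      π-injective (lookup-injective uc (trans (sym (e-lookup i)) (trans p (e-lookup j))))

  tri : (a b d : Fin n) → List ℕ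
  tri a b d = K a b ∷ K b d ∷ K a d ∷ []

  record Tri (a b d : Fin n) : Set where
    field
      a≢b   : a ≢ b
      b≢d   : b ≢ d
      a≢d   : a ≢ d
      ab≢bd : K a b ≢ K b d
      ab≢ad : K a b ≢ K a d
      bd≢ad : K b d ≢ K a d

  swap₁₂-⊆ : ∀ {a b d} → tri b a d ⊆ tri a b d
  swap₁₂-⊆ (here p)                 = here (trans p (K-sym _ _))
  swap₁₂-⊆ (there (here p))         = there (there (here p))
  swap₁₂-⊆ (there (there (here p))) = there (here p)

  swap₂₃-⊆ : ∀ {a b d} → tri a d b ⊆ tri a b d
  swap₂₃-⊆ (here p)                 = there (there (here p))
  swap₂₃-⊆ (there (here p))         = there (here (trans p (K-sym _ _)))
  swap₂₃-⊆ (there (there (here p))) = here p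

  swap₁₂ : ∀ {a b d} → Tri a b d → Tri b a d
  swap₁₂ {a} {b} t = record
    { a≢b = a≢b ∘ sym ; b≢d = a≢d ; a≢d = b≢d
    ; ab≢bd = ab≢ad ∘ trans (K-sym a b) ; ab≢ad = ab≢bd ∘ trans (K-sym a b) ; bd≢ad = bd≢ad ∘ sym }
    where open Tri t

  swap₂₃ : ∀ {a b d} → Tri a b d → Tri a d b
  swap₂₃ {a} {b} {d} t = record
    { a≢b = a≢d ; b≢d = b≢d ∘ sym ; a≢d = a≢b
    ; ab≢bd = λ e → bd≢ad (trans (K-sym b d) (sym e)) ; ab≢ad = ab≢ad ∘ sym
    ; bd≢ad = λ e → ab≢bd (sym (trans (K-sym b d) e)) }
    where open Tri t

  tri-edge : ∀ {a b d u v} → u ∈ a ∷ b ∷ d ∷ [] → v ∈ a ∷ b ∷ d ∷ [] → u ≢ v → K u v ∈ tri a b d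
  tri-edge (here refl) (here refl) ne = contradiction refl ne
  tri-edge (here refl) (there (here refl)) _ = here refl
  tri-edge (here refl) (there (there (here refl))) _ = there (there (here refl))
  tri-edge (there (here refl)) (here refl) _ = here (K-sym _ _)
  tri-edge (there (here refl)) (there (here refl)) ne = contradiction refl ne
  tri-edge (there (here refl)) (there (there (here refl))) _ = there (here refl)
  tri-edge (there (there (here refl))) (here refl) _ = there (there (here (K-sym _ _)))
  tri-edge (there (there (here refl))) (there (here refl)) _ = there (here (K-sym _ _))
  tri-edge (there (there (here refl))) (there (there (here refl))) ne = contradiction refl ne

  tri-unique : ∀ {a b d} → Tri a b d → Unique (tri a b d)
  tri-unique t = (ab≢bd ∷ ab≢ad ∷ []) ∷ (bd≢ad ∷ []) ∷ [] ∷ []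
    where open Tri t

  vertices-unique : ∀ {a b d} → Tri a b d → Unique (a ∷ b ∷ d ∷ [])
  vertices-unique t = (a≢b ∷ a≢d ∷ []) ∷ (b≢d ∷ []) ∷ [] ∷ []
    where open Tri t

  -- A rainbow K_4 minus the edge `d e`: two triangles on the common edge `a b`, with five colours
  -- in all. The colour of `d e` is left open.
  record Diamond (a b d e : Fin n) : Set where
    field
      abd      : Tri a b d
      e∉abd    : e ∉ a ∷ b ∷ d ∷ []
      ae∉tri   : K a e ∉ tri a b d
      be∉ae∷tri : K b e ∉ K a e ∷ tri a b d

  diamond : (a b d e : Fin n) → List ℕ
  diamond a b d e = K b e ∷ K a e ∷ tri a b d

  colours : List (Fin n) → List ℕ
  colours []       = []
  colours (v ∷ vs) = map (K v) vs ++ colours vs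

  edge∈colours : ∀ {S u v} → u ∈ S → v ∈ S → u ≢ v → K u v ∈ colours S
  edge∈colours (here refl) (here refl) u≢v = contradiction refl u≢v
  edge∈colours (here refl) (there v∈) _ = ∈-++⁺ˡ (∈-map⁺ (K _) v∈)
  edge∈colours {s ∷ S} {u} (there u∈) (here refl) _ =
    subst (_∈ colours (s ∷ S)) (K-sym s u) (∈-++⁺ˡ (∈-map⁺ (K s) u∈))
  edge∈colours {s ∷ S} (there u∈) (there v∈) u≢v = ∈-++⁺ʳ (map (K s) S) (edge∈colours u∈ v∈ u≢v)

  Occurs : List (Fin n) → ℕ → Set
  Occurs S ℓ = Any (λ u → Any (λ v → u ≢ v × K u v ≡ ℓ) S) S

  occurs? : ∀ S ℓ → Dec (Occurs S ℓ)
  occurs? S ℓ = Any.any? (λ u → Any.any? (λ v → ¬? (u Fin.≟ v) ×-dec (K u v ℕ.≟ ℓ)) S) S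

  occurs⁻ : ∀ {S ℓ} → Occurs S ℓ → ∃₂ λ u v → u ∈ S × v ∈ S × u ≢ v × K u v ≡ ℓ
  occurs⁻ p with find p
  ... | u , u∈ , q with find q
  ... | v , v∈ , u≢v , e = u , v , u∈ , v∈ , u≢v , e

  occurs⁺ : ∀ {S u v} → u ∈ S → v ∈ S → u ≢ v → Occurs S (K u v)
  occurs⁺ u∈ v∈ u≢v = lose u∈ (lose v∈ (u≢v , refl))

  occurs⇒∈ : ∀ {S L} F → (∀ {u v} → u ∈ S → v ∈ S → u ≢ v → K u v ∈ F) → All (Occurs S) L → L ⊆ F
  occurs⇒∈ F cover occ ℓ∈ with occurs⁻ (All.lookup occ ℓ∈)
  ... | _ , _ , u∈ , v∈ , u≢v , refl = cover u∈ v∈ u≢v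

  -- Upper bound

  module BullFree (free : ¬ RainbowBull c) where

    -- Otherwise the edges `a x` and `b y` complete the triangle to a rainbow bull. All later uses
    -- of bull avoidance go through this lemma.
    pendant : ∀ {a b d x y} → Tri a b d → x ∉ a ∷ b ∷ d ∷ [] → y ∉ a ∷ b ∷ d ∷ [] → x ≢ y →
              K a x ∉ tri a b d → K b y ∈ K a x ∷ tri a b d
    pendant t x∉ y∉ x≢y ax∉ = decidable-stable (_ ∈ℕ? _) λ by∉ → free
      (bull (cons-unique (λ { (here e) → x≢y (sym e) ; (there p) → y∉ p })
                         (cons-unique x∉ (vertices-unique t)))
            (cons-unique by∉ (cons-unique ax∉ (tri-unique t))))

    pendant₁₃ : ∀ {a b d x y} → Tri a b d → x ∉ a ∷ b ∷ d ∷ [] → y ∉ a ∷ b ∷ d ∷ [] → x ≢ y →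
                K a x ∉ tri a b d → K d y ∈ K a x ∷ tri a b d
    pendant₁₃ t x∉ y∉ x≢y ax∉
      with pendant (swap₂₃ t) (x∉ ∘ swap₂₃-∈) (y∉ ∘ swap₂₃-∈) x≢y (ax∉ ∘ swap₂₃-⊆)
    ... | here p  = here p
    ... | there p = there (swap₂₃-⊆ p)

    module _ {a b d e} (D : Diamond a b d e) where
      open Diamond D
      open Tri abd

      private
        e≢a : e ≢ a
        e≢a = e∉abd ∘ here
        e≢b : e ≢ b
        e≢b = e∉abd ∘ there ∘ here
        e≢d : e ≢ d
        e≢d = e∉abd ∘ there ∘ there ∘ here
        be∉tri : K b e ∉ tri a b d
        be∉tri = be∉ae∷tri ∘ there

      abe : Tri a b e
      abe = record
        { a≢b = a≢b ; b≢d = e≢b ∘ sym ; a≢d = e≢a ∘ sym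
        ; ab≢bd = be∉tri ∘ here ∘ sym ; ab≢ad = ae∉tri ∘ here ∘ sym ; bd≢ad = be∉ae∷tri ∘ here }

      bd∉abe : K b d ∉ tri a b e
      bd∉abe (here p)                 = ab≢bd (sym p)
      bd∉abe (there (here p))         = be∉tri (there (here (sym p)))
      bd∉abe (there (there (here p))) = ae∉tri (there (here (sym p)))

      abe⊆ : tri a b e ⊆ diamond a b d e
      abe⊆ (here p)                 = there (there (here p))
      abe⊆ (there (here p))         = here p
      abe⊆ (there (there (here p))) = there (here p)

      -- Each case is a bull on the triangle `a b d` or `a b e`: one pendant edge goes to `x`, the
      -- other is a diamond edge outside that triangle.
      diamond-attach : ∀ {u x} → x ∉ a ∷ b ∷ d ∷ e ∷ [] → u ∈ a ∷ b ∷ d ∷ e ∷ [] →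
                       K u x ∈ diamond a b d e
      diamond-attach {x = x} x∉ = go
        where
        x∉abd : x ∉ a ∷ b ∷ d ∷ []
        x∉abd (here p)                 = x∉ (here p)
        x∉abd (there (here p))         = x∉ (there (here p))
        x∉abd (there (there (here p))) = x∉ (there (there (here p)))
        x≢e : x ≢ e
        x≢e = x∉ ∘ there ∘ there ∘ there ∘ here
        go : ∀ {u} → u ∈ a ∷ b ∷ d ∷ e ∷ [] → K u x ∈ diamond a b d e
        go (here refl) = decidable-stable (_ ∈ℕ? _) λ ax∉ →
          case-be ax∉ (pendant abd x∉abd e∉abd x≢e (ax∉ ∘ there ∘ there))
          where
          case-be : K a x ∉ diamond a b d e → ¬ (K b e ∈ K a x ∷ tri a b d)
          case-be ax∉ (here p)  = ax∉ (here (sym p))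
          case-be ax∉ (there p) = be∉tri p
        go (there (here refl)) = there (pendant abd e∉abd x∉abd (x≢e ∘ sym) ae∉tri)
        go (there (there (here refl))) = there (pendant₁₃ abd e∉abd x∉abd (x≢e ∘ sym) ae∉tri)
        go (there (there (there (here refl))))
          with pendant₁₃ (swap₁₂ abe) d∉ x∉bae (λ { refl → x∉abd (there (there (here refl))) })
                         (bd∉abe ∘ swap₁₂-⊆)
          where
          d∉ : d ∉ b ∷ a ∷ e ∷ []
          d∉ (here p)                 = b≢d (sym p)
          d∉ (there (here p))         = a≢d (sym p)
          d∉ (there (there (here p))) = e≢d (sym p)
          x∉bae : x ∉ b ∷ a ∷ e ∷ []
          x∉bae (here p)                 = x∉abd (there (here p))
          x∉bae (there (here p))         = x∉abd (here p)
          x∉bae (there (there (here p))) = x≢e p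
        ... | here p  = there (there (there (here p)))
        ... | there p = abe⊆ (swap₁₂-⊆ p)

      no-rainbow-K₄ : ∀ {x} → x ∉ a ∷ b ∷ d ∷ e ∷ [] → K d e ∈ diamond a b d e
      no-rainbow-K₄ {x} x∉ = decidable-stable (_ ∈ℕ? _) go
        where
        -- The pendant edge at a can only repeat a colour of each of the three triangles
        -- at a, and these have no common colour.
        apex : ∀ {p q r} → Tri a p q → r ∉ a ∷ p ∷ q ∷ [] → x ∉ a ∷ p ∷ q ∷ [] → x ≢ r →
               K p r ∉ tri a p q → K q r ∉ tri a p q → K p r ≢ K q r → K a x ∈ tri a p q
        apex t r∉ x∉ x≢r pr∉ qr∉ ne = decidable-stable (_ ∈ℕ? _) λ ax∉ →
          clash (pendant t x∉ r∉ x≢r ax∉) (pendant₁₃ t x∉ r∉ x≢r ax∉)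
          where
          clash : K _ _ ∈ K a x ∷ tri a _ _ → ¬ (K _ _ ∈ K a x ∷ tri a _ _)
          clash (here p)  (here q)  = ne (trans p (sym q))
          clash (here p)  (there q) = qr∉ q
          clash (there p) _         = pr∉ p
        x≢a : x ≢ a
        x≢a = x∉ ∘ here
        x≢b : x ≢ b
        x≢b = x∉ ∘ there ∘ here
        x≢d : x ≢ d
        x≢d = x∉ ∘ there ∘ there ∘ here
        x≢e : x ≢ e
        x≢e = x∉ ∘ there ∘ there ∘ there ∘ here
        go : ¬ (K d e ∉ diamond a b d e)
        go de∉ = combine
          (apex abd e∉abd (∉₃ x≢a x≢b x≢d) x≢e be∉tri (de∉ ∘ there ∘ there) (de∉ ∘ here ∘ sym))
          (apex abe (∉₃ (a≢d ∘ sym) (b≢d ∘ sym) (e≢d ∘ sym)) (∉₃ x≢a x≢b x≢e) x≢d bd∉abe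
            (λ p → de∉ (abe⊆ (subst (_∈ tri a b e) (K-sym e d) p)))
            (λ p → de∉ (there (there (there (here (trans (K-sym d e) (sym p))))))))
          (apex ade (∉₃ (a≢b ∘ sym) b≢d (e≢b ∘ sym)) (∉₃ x≢a x≢d x≢e) x≢b db∉ade eb∉ade
            (λ p → be∉tri (there (here (trans (K-sym b e) (trans (sym p) (K-sym d b)))))))
          where
          ade : Tri a d e
          ade = record
            { a≢b = a≢d ; b≢d = e≢d ∘ sym ; a≢d = e≢a ∘ sym
            ; ab≢bd = λ p → de∉ (there (there (there (there (here (sym p))))))
            ; ab≢ad = λ p → ae∉tri (there (there (here (sym p))))
            ; bd≢ad = λ p → de∉ (there (here p)) }
          db∉ade : K d b ∉ tri a d e
          db∉ade (here p) = bd≢ad (trans (K-sym b d) p)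
          db∉ade (there (here p)) = de∉ (there (there (there (here (trans (sym p) (K-sym d b))))))
          db∉ade (there (there (here p))) = ae∉tri (there (here (trans (sym p) (K-sym d b))))
          eb∉ade : K e b ∉ tri a d e
          eb∉ade (here p) = be∉tri (there (there (here (trans (K-sym b e) p))))
          eb∉ade (there (here p)) = de∉ (here (trans (sym p) (K-sym e b)))
          eb∉ade (there (there (here p))) = be∉ae∷tri (here (trans (K-sym b e) p))
          combine : ∀ {ℓ} → ℓ ∈ tri a b d → ℓ ∈ tri a b e → ¬ (ℓ ∈ tri a d e)
          combine (here p) _ (here q) = ab≢ad (trans (sym p) q)
          combine (here p) _ (there (here q)) = de∉ (there (there (here (trans (sym q) p))))
          combine (here p) _ (there (there (here q))) = ae∉tri (here (trans (sym q) p))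
          combine (there (here p)) q _ = bd∉abe (subst (_∈ _) p q)
          combine (there (there (here p))) (here q) _ = ab≢ad (trans (sym q) p)
          combine (there (there (here p))) (there (here q)) _ =
            be∉tri (there (there (here (trans (sym q) p))))
          combine (there (there (here p))) (there (there (here q))) _ =
            ae∉tri (there (there (here (trans (sym q) p))))

    -- Colours lost by deleting vertices

    module Within (V : List (Fin n)) where

      Lost : List (Fin n) → ℕ → Set
      Lost R ℓ = ∀ {u w} → u ∈ V → w ∈ V → u ∉ R → w ∉ R → u ≢ w → K u w ≢ ℓ

      -- Deleting R from V loses a colour outside E.
      Loss : List (Fin n) → List ℕ → Set
      Loss R E = ∃₂ λ u v → u ∈ R × v ∈ V × u ≢ v × K u v ∉ E × Lost R (K u v)

      record VTri (a b d : Fin n) : Set where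
        constructor vtri
        field
          triangle : Tri a b d
          a∈V : a ∈ V
          b∈V : b ∈ V
          d∈V : d ∈ V
        open Tri triangle public

      vswap₁₂ : ∀ {a b d} → VTri a b d → VTri b a d
      vswap₁₂ (vtri t a∈ b∈ d∈) = vtri (swap₁₂ t) b∈ a∈ d∈

      vswap₂₃ : ∀ {a b d} → VTri a b d → VTri a d b
      vswap₂₃ (vtri t a∈ b∈ d∈) = vtri (swap₂₃ t) a∈ d∈ b∈

      lost-∉tri : ∀ {R ℓ a b d} → Lost R ℓ → VTri a b d → a ∉ R → b ∉ R → d ∉ R → ℓ ∉ tri a b d
      lost-∉tri L t a∉ b∉ d∉ (here p) = L a∈V b∈V a∉ b∉ a≢b (sym p)
        where open VTri t
      lost-∉tri L t a∉ b∉ d∉ (there (here p)) = L b∈V d∈V b∉ d∉ b≢d (sym p)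
        where open VTri t
      lost-∉tri L t a∉ b∉ d∉ (there (there (here p))) = L a∈V d∈V a∉ d∉ a≢d (sym p)
        where open VTri t

      -- Four vertices without a diamond

      module FourSets (no-diamond : ∀ {a b d e} → VTri a b d → e ∈ V → ¬ Diamond a b d e) where

        within-diamond : ∀ {a b d e} → VTri a b d → e ∈ V → e ∉ a ∷ b ∷ d ∷ [] →
                         K a e ∉ tri a b d → K b e ∈ K a e ∷ tri a b d
        within-diamond t e∈V e∉ ae∉ = decidable-stable (_ ∈ℕ? _) λ be∉ → no-diamond t e∈V record
          { abd = VTri.triangle t ; e∉abd = e∉ ; ae∉tri = ae∉ ; be∉ae∷tri = be∉ }

        -- Two different new colours on the edges from `e` to the triangle would make a diamond, so
        -- one colour `ℓ` besides the three of the triangle suffices.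
        four-colours : ∀ {a b d e} → VTri a b d → e ∈ V → e ∉ a ∷ b ∷ d ∷ [] →
                       ∃ λ F → length F ≡ 4 × colours (a ∷ b ∷ d ∷ e ∷ []) ⊆ F
        four-colours {a} {b} {d} {e} t e∈V e∉ = pick (K a e ∈ℕ? tri a b d) (K b e ∈ℕ? tri a b d)
          where
          Covered : ℕ → Set
          Covered ℓ = K a e ∈ ℓ ∷ tri a b d × K b e ∈ ℓ ∷ tri a b d × K d e ∈ ℓ ∷ tri a b d
          cover : ∀ {ℓ} → Covered ℓ → colours (a ∷ b ∷ d ∷ e ∷ []) ⊆ ℓ ∷ tri a b d
          cover (ae , be , de) = list-⊆
            (there (here refl) ∷ there (there (there (here refl))) ∷ ae ∷
             there (there (here refl)) ∷ be ∷ de ∷ [])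
          conclude : ∀ {ℓ} → Covered ℓ → ∃ λ F → length F ≡ 4 × colours (a ∷ b ∷ d ∷ e ∷ []) ⊆ F
          conclude {ℓ} cv = ℓ ∷ tri a b d , refl , cover cv
          tail : ∀ {ℓ x} {xs ys : List ℕ} → xs ⊆ ys → x ∈ ℓ ∷ xs → x ∈ ℓ ∷ ys
          tail s (here p)  = here p
          tail s (there p) = there (s p)
          pick : Dec (K a e ∈ tri a b d) → Dec (K b e ∈ tri a b d) →
                 ∃ λ F → length F ≡ 4 × colours (a ∷ b ∷ d ∷ e ∷ []) ⊆ F
          pick (no ae∉) _ = conclude
            ( here refl , within-diamond t e∈V e∉ ae∉
            , tail swap₂₃-⊆ (within-diamond (vswap₂₃ t) e∈V (e∉ ∘ swap₂₃-∈) (ae∉ ∘ swap₂₃-⊆)))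
          pick (yes ae∈) (no be∉) = conclude
            ( there ae∈ , here refl
            , tail (swap₁₂-⊆ ∘ swap₂₃-⊆) (within-diamond (vswap₂₃ (vswap₁₂ t)) e∈V
                (e∉ ∘ swap₁₂-∈ ∘ swap₂₃-∈) (be∉ ∘ swap₁₂-⊆ ∘ swap₂₃-⊆)))
          pick (yes ae∈) (yes be∈) = conclude (there ae∈ , there be∈ , here refl)

        -- If `p q r` is rainbow, `four-colours` applies. If not, two of its edges agree and five
        -- edges carry all colours; five colours would then make these edges rainbow, hence `p q s`
        -- a rainbow triangle, and `four-colours` applies to that one.
        four-set-bound : ∀ {p q r s} → Unique (p ∷ q ∷ r ∷ s ∷ []) → p ∷ q ∷ r ∷ s ∷ [] ⊆ V →
                         ∀ {L} → Unique L → All (Occurs (p ∷ q ∷ r ∷ s ∷ [])) L → length L ≤ 4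
        four-set-bound {p} {q} {r} {s}
          ((p≢q ∷ p≢r ∷ p≢s ∷ []) ∷ (q≢r ∷ q≢s ∷ []) ∷ (r≢s ∷ []) ∷ [] ∷ []) S⊆V {L} uL occ =
          [ id , (λ (_ , |F|≡4 , cover) →
               ℕ.≤-trans (unique-⊆⇒length≤ uL (cover ∘ L⊆)) (ℕ.≤-reflexive |F|≡4)) ]′
            split
          where
          p∈V = S⊆V (here refl)
          q∈V = S⊆V (there (here refl))
          r∈V = S⊆V (there (there (here refl)))
          s∈V = S⊆V (there (there (there (here refl))))
          L⊆ : L ⊆ colours (p ∷ q ∷ r ∷ s ∷ [])
          L⊆ = occurs⇒∈ _ edge∈colours occ
          Goal : Set
          Goal = length L ≤ 4 ⊎ ∃ λ F → length F ≡ 4 × colours (p ∷ q ∷ r ∷ s ∷ []) ⊆ F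
          pqs : K p q ≢ K q s → K p q ≢ K p s → K q s ≢ K p s → Goal
          pqs n₁ n₂ n₃ with four-colours (vtri (record
            { a≢b = p≢q ; b≢d = q≢s ; a≢d = p≢s ; ab≢bd = n₁ ; ab≢ad = n₂ ; bd≢ad = n₃ }) p∈V q∈V s∈V)
            r∈V (∉₃ (p≢r ∘ sym) (q≢r ∘ sym) r≢s)
          ... | F , |F| , cover = inj₂ (F , |F| , cover ∘ list-⊆
            (here refl ∷ there (there (here refl)) ∷ there (here refl) ∷
             there (there (there (there (here refl)))) ∷ there (there (there (here refl))) ∷
             subst (_∈ colours (p ∷ q ∷ s ∷ r ∷ [])) (K-sym s r)
               (there (there (there (there (there (here refl)))))) ∷ []))
          five : ∀ F → colours (p ∷ q ∷ r ∷ s ∷ []) ⊆ F → length F ≡ 5 → (Unique F → Goal) → Goal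
          five F cover |F| k with length L ℕ.≤? 4
          ... | yes le = inj₁ le
          ... | no ¬le = k (covering-unique ℕ._≟_ F uL (cover ∘ L⊆)
            (ℕ.≤-trans (ℕ.≤-reflexive |F|) (ℕ.≰⇒> ¬le)))
          split : Goal
          split with K p q ℕ.≟ K q r | K p q ℕ.≟ K p r | K q r ℕ.≟ K p r
          ... | no n₁ | no n₂ | no n₃ = inj₂ (four-colours (vtri (record
            { a≢b = p≢q ; b≢d = q≢r ; a≢d = p≢r ; ab≢bd = n₁ ; ab≢ad = n₂ ; bd≢ad = n₃ }) p∈V q∈V r∈V)
            s∈V (∉₃ (p≢s ∘ sym) (q≢s ∘ sym) (r≢s ∘ sym)))
          ... | yes e | _ | _ = five (K p q ∷ K p s ∷ K q s ∷ K p r ∷ K r s ∷ [])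
            (list-⊆ (here refl ∷ there (there (there (here refl))) ∷ there (here refl) ∷
              here (sym e) ∷ there (there (here refl)) ∷ there (there (there (there (here refl)))) ∷ []))
            refl λ { ((n₂ ∷ n₁ ∷ _) ∷ (n₃ ∷ _) ∷ _) → pqs n₁ n₂ (n₃ ∘ sym) }
          ... | no _ | yes e | _ = five (K p q ∷ K p s ∷ K q s ∷ K q r ∷ K r s ∷ [])
            (list-⊆ (here refl ∷ here (sym e) ∷ there (here refl) ∷
              there (there (there (here refl))) ∷ there (there (here refl)) ∷
              there (there (there (there (here refl)))) ∷ []))
            refl λ { ((n₂ ∷ n₁ ∷ _) ∷ (n₃ ∷ _) ∷ _) → pqs n₁ n₂ (n₃ ∘ sym) }
          ... | no _ | no _ | yes e = five (K p q ∷ K p s ∷ K q s ∷ K p r ∷ K r s ∷ [])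
            (list-⊆ (here refl ∷ there (there (there (here refl))) ∷ there (here refl) ∷
              there (there (there (here e))) ∷ there (there (here refl)) ∷
              there (there (there (there (here refl)))) ∷ []))
            refl λ { ((n₂ ∷ n₁ ∷ _) ∷ (n₃ ∷ _) ∷ _) → pqs n₁ n₂ (n₃ ∘ sym) }

      -- The edges meeting a diamond

      module DiamondIn {a b d e} (D : Diamond a b d e) (abd∈V : VTri a b d) (e∈V : e ∈ V)
                       {x} (x∉D : x ∉ a ∷ b ∷ d ∷ e ∷ []) where
        open Diamond D
        open VTri abd∈V

        D⁴ : List (Fin n)
        D⁴ = a ∷ b ∷ d ∷ e ∷ []

        CD : List ℕ
        CD = diamond a b d e

        flip : ∀ {u v} → K u v ∈ CD → K v u ∈ CD
        flip = subst (_∈ CD) (K-sym _ _)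

        inner-to-e : ∀ {u} → u ∈ a ∷ b ∷ d ∷ [] → K u e ∈ CD
        inner-to-e (here refl)                 = there (here refl)
        inner-to-e (there (here refl))         = here refl
        inner-to-e (there (there (here refl))) = no-rainbow-K₄ D x∉D

        D⁴-split : ∀ {u} → u ∈ D⁴ → u ∈ a ∷ b ∷ d ∷ [] ⊎ u ≡ e
        D⁴-split (here p)                         = inj₁ (here p)
        D⁴-split (there (here p))                 = inj₁ (there (here p))
        D⁴-split (there (there (here p)))         = inj₁ (there (there (here p)))
        D⁴-split (there (there (there (here p)))) = inj₂ p

        -- Edges leaving the diamond are handled by `diamond-attach`, its sixth edge by
        -- `no-rainbow-K₄` with `x` as fifth vertex.
        touching∈CD : ∀ {u v} → u ∈ D⁴ → u ≢ v → K u v ∈ CD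
        touching∈CD {u} {v} u∈ u≢v with v ∈F? D⁴
        ... | no v∉ = diamond-attach D v∉ u∈
        ... | yes v∈ with D⁴-split u∈ | D⁴-split v∈
        ... | inj₁ p    | inj₁ q    = there (there (tri-edge p q u≢v))
        ... | inj₁ p    | inj₂ refl = inner-to-e p
        ... | inj₂ refl | inj₁ q    = flip (inner-to-e q)
        ... | inj₂ refl | inj₂ refl = contradiction refl u≢v

        -- The diamond survives the deletion of `R`, and so do its five colours.
        lost-∉CD : ∀ {R ℓ} → Lost R ℓ → (∀ {u} → u ∈ D⁴ → u ∉ R) → ℓ ∉ CD
        lost-∉CD L D∩R (here p) = L b∈V e∈V (D∩R (there (here refl)))
          (D∩R (there (there (there (here refl))))) (e∉abd ∘ there ∘ here ∘ sym) (sym p)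
        lost-∉CD L D∩R (there (here p)) = L a∈V e∈V (D∩R (here refl))
          (D∩R (there (there (there (here refl))))) (e∉abd ∘ here ∘ sym) (sym p)
        lost-∉CD L D∩R (there (there p)) = lost-∉tri L abd∈V (D∩R (here refl))
          (D∩R (there (here refl))) (D∩R (there (there (here refl)))) p

        no-5-loss : ¬ Loss D⁴ CD
        no-5-loss (_ , _ , u∈ , _ , u≢v , ∉CD , _) = ∉CD (touching∈CD u∈ u≢v)

      -- Private colours, and diamonds in a minimal set

      module Lossy
        (P₁ : ∀ {v} → v ∈ V → ∀ E → length E ≤ 1 → Loss (v ∷ []) E)
        (P₃ : ∀ {a b d} → VTri a b d → ∀ E → length E ≤ 3 → Loss (a ∷ b ∷ d ∷ []) E)
        where

        record TriangleAt (v : Fin n) : Set where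
          field
            {p q}   : Fin n
            vpq     : VTri v p q
            vp-lost : Lost (v ∷ []) (K v p)
            vq-lost : Lost (v ∷ []) (K v q)
          open VTri vpq public

        -- Two colours are lost with `v`, say on `v p` and `v q`. The edge `p q` avoids `v` and so
        -- has neither of them.
        triangle-at : ∀ {v} → v ∈ V → TriangleAt v
        triangle-at {v} v∈V with P₁ v∈V [] z≤n
        ... | _ , p , here refl , p∈V , v≢p , _ , vp-lost with P₁ v∈V (K v p ∷ []) (s≤s z≤n)
        ... | _ , q , here refl , q∈V , v≢q , vq∉ , vq-lost = record
          { vpq = vtri (record
            { a≢b = v≢p ; b≢d = p≢q ; a≢d = v≢q
            ; ab≢bd = pq≢ vp-lost ∘ sym ; ab≢ad = vq∉ ∘ here ∘ sym ; bd≢ad = pq≢ vq-lost }) v∈V p∈V q∈V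
          ; vp-lost = vp-lost ; vq-lost = vq-lost }
          where
          p≢q : p ≢ q
          p≢q refl = vq∉ (here refl)
          pq≢ : ∀ {ℓ} → Lost (v ∷ []) ℓ → K p q ≢ ℓ
          pq≢ L = L p∈V q∈V (∉₁ (v≢p ∘ sym)) (∉₁ (v≢q ∘ sym)) p≢q

        module _ {a b d e} (D : Diamond a b d e) (abd∈V : VTri a b d) (e∈V : e ∈ V)
                 {x} (x∉D : x ∉ a ∷ b ∷ d ∷ e ∷ []) where
          open DiamondIn D abd∈V e∈V x∉D

          -- The rainbow triangle at `x` is disjoint from the diamond in vertices and colours. A
          -- further colour lost with that triangle turns out to be a diamond colour, yet diamond
          -- colours survive its deletion.
          diamond-no-4-loss : x ∈ V → ¬ (∀ E → length E ≤ 4 → Loss D⁴ E)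
          diamond-no-4-loss x∈V P₄ = go (P₃ vpq (tri x p q) ℕ.≤-refl)
            where
            open TriangleAt (triangle-at x∈V) using (vpq; vp-lost; vq-lost; p; q)
            module T = VTri vpq

            -- With the other four diamond colours excluded, some colour is still lost with the
            -- diamond; its edge meets the diamond, so it can only be `ℓ`.
            CD-lost : ∀ {ℓ} → ℓ ∈ CD → Lost D⁴ ℓ
            CD-lost {ℓ} ℓ∈ with P₄ (filter (¬? ∘ (ℕ._≟ ℓ)) CD)
              (ℕ.≤-pred (filter-notAll (¬? ∘ (ℕ._≟ ℓ)) CD (Any.map (λ e ne → ne (sym e)) ℓ∈)))
            ... | u , v , u∈ , _ , u≢v , uv∉ , L with K u v ℕ.≟ ℓ
            ... | yes refl = L
            ... | no ne = contradiction (∈-filter⁺ (¬? ∘ (ℕ._≟ ℓ)) (touching∈CD u∈ u≢v) ne) uv∉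

            private-outside : ∀ {r} → x ≢ r → Lost (x ∷ []) (K x r) → r ∉ D⁴
            private-outside x≢r L r∈ = lost-∉CD L (λ { u∈ (here refl) → x∉D u∈ })
              (flip (touching∈CD r∈ (x≢r ∘ sym)))
            p∉D : p ∉ D⁴
            p∉D = private-outside T.a≢b vp-lost
            q∉D : q ∉ D⁴
            q∉D = private-outside T.a≢d vq-lost

            CD∩tri : ∀ {ℓ} → ℓ ∈ CD → ℓ ∉ tri x p q
            CD∩tri ℓ∈ = lost-∉tri (CD-lost ℓ∈) vpq x∉D p∉D q∉D

            D∩xpq : ∀ {u} → u ∈ D⁴ → u ∉ x ∷ p ∷ q ∷ []
            D∩xpq u∈ (here refl)                 = x∉D u∈
            D∩xpq u∈ (there (here refl))         = p∉D u∈
            D∩xpq u∈ (there (there (here refl))) = q∉D u∈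

            -- For `v` outside the diamond, `w v` and `r a` are pendant edges on the triangle
            -- `w r s`. The colour of `r a` belongs to the diamond and not to the triangle, so bull
            -- avoidance makes it equal to that of `w v`.
            at-apex : ∀ {w r s v} → Tri w r s → r ∉ D⁴ → v ∉ w ∷ r ∷ s ∷ [] → a ∉ w ∷ r ∷ s ∷ [] →
                      K w v ∉ tri w r s → (∀ {ℓ} → ℓ ∈ CD → ℓ ∉ tri w r s) → w ∉ D⁴ → K w v ∈ CD
            at-apex {w} {r} {v = v} t r∉ v∉ a∉ wv∉ disj w∉ with v ∈F? D⁴
            ... | yes v∈ = flip (touching∈CD v∈ λ { refl → w∉ v∈ })
            ... | no v∉D with pendant t v∉ a∉ (λ { refl → v∉D (here refl) }) wv∉
            ... | here e  = subst (_∈ CD) e ra∈CD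
              where
              ra∈CD : K r a ∈ CD
              ra∈CD = flip (touching∈CD (here refl) λ { refl → r∉ (here refl) })
            ... | there m = contradiction m
              (disj (flip (touching∈CD (here refl) λ { refl → r∉ (here refl) })))

            go : ¬ Loss (x ∷ p ∷ q ∷ []) (tri x p q)
            go (u , v , u∈ , v∈V , u≢v , uv∉ , L) = lost-∉CD L D∩xpq (uv∈CD u∈ uv∉)
              where
              v∉ : v ∉ x ∷ p ∷ q ∷ []
              v∉ v∈ = uv∉ (tri-edge u∈ v∈ u≢v)
              a∉ : a ∉ x ∷ p ∷ q ∷ []
              a∉ = D∩xpq (here refl)
              uv∈CD : ∀ {u} → u ∈ x ∷ p ∷ q ∷ [] → K u v ∉ tri x p q → K u v ∈ CD
              uv∈CD (here refl) uv∉ = at-apex T.triangle p∉D v∉ a∉ uv∉ CD∩tri x∉D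
              uv∈CD (there (here refl)) uv∉ = at-apex (swap₁₂ T.triangle) x∉D
                (v∉ ∘ swap₁₂-∈) (a∉ ∘ swap₁₂-∈) (uv∉ ∘ swap₁₂-⊆)
                (λ m → CD∩tri m ∘ swap₁₂-⊆) p∉D
              uv∈CD (there (there (here refl))) uv∉ = at-apex (swap₁₂ (swap₂₃ T.triangle)) x∉D
                (v∉ ∘ swap₂₃-∈ ∘ swap₁₂-∈) (a∉ ∘ swap₂₃-∈ ∘ swap₁₂-∈) (uv∉ ∘ swap₂₃-⊆ ∘ swap₁₂-⊆)
                (λ m → CD∩tri m ∘ swap₂₃-⊆ ∘ swap₁₂-⊆) q∉D

        -- Rainbow paws in a minimal set without diamonds

        module DiamondFree (no-diamond : ∀ {a b d e} → VTri a b d → e ∈ V → ¬ Diamond a b d e) where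
          open FourSets no-diamond using (within-diamond)

          record Paw (a b d x : Fin n) : Set where
            constructor paw
            field
              abd    : VTri a b d
              x∈V    : x ∈ V
              x∉abd  : x ∉ a ∷ b ∷ d ∷ []
              ax∉tri : K a x ∉ tri a b d
            open VTri abd public

          mirror : ∀ {a b d x} → Paw a b d x → Paw a d b x
          mirror (paw t x∈ x∉ ax∉) = paw (vswap₂₃ t) x∈ (x∉ ∘ swap₂₃-∈) (ax∉ ∘ swap₂₃-⊆)

          -- A new colour on `b y` would give a bull if `y` differs from `x`, and a diamond if `y`
          -- is `x`.
          spread : ∀ {a b d x y} → Paw a b d x → y ∈ V → y ∉ a ∷ b ∷ d ∷ [] → K b y ∈ K a x ∷ tri a b d
          spread {x = x} {y} P y∈V y∉ with x Fin.≟ y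
          ... | no x≢y = pendant (VTri.triangle (Paw.abd P)) (Paw.x∉abd P) y∉ x≢y (Paw.ax∉tri P)
          ... | yes refl = within-diamond (Paw.abd P) y∈V y∉ (Paw.ax∉tri P)

          -- Of the four colours that `spread` permits, those of `a x` and `a d` also occur away
          -- from `b`.
          private-at-b : ∀ {a b d x y} → Paw a b d x → y ∈ V → b ≢ y → Lost (b ∷ []) (K b y) →
                         K b y ∈ K a b ∷ K b d ∷ []
          private-at-b {a} {b} {d} {x} {y} P y∈V b≢y L with y Fin.≟ a | y Fin.≟ d
          ... | yes refl | _        = here (K-sym _ _)
          ... | no _     | yes refl = there (here refl)
          ... | no y≢a   | no y≢d with spread P y∈V (∉₃ y≢a (b≢y ∘ sym) y≢d)
          ... | here e = contradiction (sym e)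
            (L a∈V x∈V (∉₁ a≢b) (∉₁ (x∉abd ∘ there ∘ here)) (x∉abd ∘ here ∘ sym))
            where open Paw P
          ... | there (here e)                 = here e
          ... | there (there (here e))         = there (here e)
          ... | there (there (there (here e))) = contradiction (sym e)
            (L a∈V d∈V (∉₁ a≢b) (∉₁ (b≢d ∘ sym)) a≢d)
            where open Paw P

          -- At least two colours are private to `b`, and `private-at-b` leaves only two candidates,
          -- so both are private. Excluding one yields the other, here and in `ab-private`.
          bd-private : ∀ {a b d x} → Paw a b d x → Lost (b ∷ []) (K b d)
          bd-private {a} {b} P with P₁ (Paw.b∈V P) (K a b ∷ []) ℕ.≤-refl
          ... | _ , y , here refl , y∈V , b≢y , by∉ , L with private-at-b P y∈V b≢y L
          ... | here e         = contradiction (here e) by∉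
          ... | there (here e) = subst (Lost (b ∷ [])) e L

          ab-private : ∀ {a b d x} → Paw a b d x → Lost (b ∷ []) (K a b)
          ab-private {a} {b} {d} P with P₁ (Paw.b∈V P) (K b d ∷ []) ℕ.≤-refl
          ... | _ , y , here refl , y∈V , b≢y , by∉ , L with private-at-b P y∈V b≢y L
          ... | here e         = subst (Lost (b ∷ [])) e L
          ... | there (here e) = contradiction (here e) by∉

          two-privates-at-b : ∀ {a b d x} → Paw a b d x → ¬ Loss (b ∷ []) (K a b ∷ K b d ∷ [])
          two-privates-at-b P (_ , _ , here refl , y∈V , b≢y , by∉ , L) = by∉ (private-at-b P y∈V b≢y L)

          ad-private : ∀ {a b d x} → Paw a b d x → Lost (d ∷ []) (K a d)
          ad-private = ab-private ∘ mirror

          -- By symmetry the colours of `b d` and `a d` are private to `d`, so `b y` cannot have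
          -- them.
          spread′ : ∀ {a b d x y} → Paw a b d x → y ∈ V → y ∉ a ∷ b ∷ d ∷ [] →
                    K b y ≡ K a b ⊎ K b y ≡ K a x
          spread′ {a} {b} {d} {x} {y} P y∈V y∉ with spread P y∈V y∉
          ... | here e                         = inj₂ e
          ... | there (here e)                 = inj₁ e
          ... | there (there (here e))         = contradiction e
            (bd-private (mirror P) b∈V y∈V (∉₁ b≢d) (∉₁ (y∉ ∘ there ∘ there ∘ here))
              (y∉ ∘ there ∘ here ∘ sym) ∘ λ e → trans e (K-sym b d))
            where open Paw P
          ... | there (there (there (here e))) = contradiction e
            (ad-private P b∈V y∈V (∉₁ b≢d) (∉₁ (y∉ ∘ there ∘ there ∘ here)) (y∉ ∘ there ∘ here ∘ sym))
            where open Paw P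

          -- Take a triangle `a p q` with private colours at `a`. Flatness keeps `p` and `q` away
          -- from `b` and `d`, and gives `p b` and `q d` the colours of `a b` and `a d`. These are
          -- private to `b` and `d`, so they are new to the triangle and complete a rainbow bull.
          not-flat : ∀ {a b d x} → Paw a b d x → ¬ (∀ {y} → y ∈ V → y ∉ a ∷ b ∷ d ∷ [] →
                        K b y ≡ K a b × K d y ≡ K a d)
          not-flat {a} {b} {d} {x} P flat = conclude
            (pendant (swap₂₃ (swap₁₂ T.triangle)) b∉ d∉ b≢d pb∉)
            where
            open Paw P
            open TriangleAt (triangle-at a∈V) using (vpq; vp-lost; vq-lost; p; q)
            module T = VTri vpq
            ≢b : ∀ {r} → Lost (a ∷ []) (K a r) → b ≢ r
            ≢b L refl = L b∈V x∈V (∉₁ (a≢b ∘ sym)) (∉₁ (x∉abd ∘ here)) (x∉abd ∘ there ∘ here ∘ sym)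
              (proj₁ (flat x∈V x∉abd))
            ≢d : ∀ {r} → Lost (a ∷ []) (K a r) → d ≢ r
            ≢d L refl = L d∈V x∈V (∉₁ (a≢d ∘ sym)) (∉₁ (x∉abd ∘ here))
              (x∉abd ∘ there ∘ there ∘ here ∘ sym)
              (proj₂ (flat x∈V x∉abd))
            outer : ∀ {r} → r ≢ a → b ≢ r → d ≢ r → r ∉ a ∷ b ∷ d ∷ []
            outer r≢a b≢r d≢r = ∉₃ r≢a (b≢r ∘ sym) (d≢r ∘ sym)
            b∉ : b ∉ p ∷ q ∷ a ∷ []
            b∉ = ∉₃ (≢b vp-lost) (≢b vq-lost) (a≢b ∘ sym)
            d∉ : d ∉ p ∷ q ∷ a ∷ []
            d∉ = ∉₃ (≢d vp-lost) (≢d vq-lost) (a≢d ∘ sym)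
            pb≡ab : K p b ≡ K a b
            pb≡ab = trans (K-sym p b)
              (proj₁ (flat T.b∈V (outer (T.a≢b ∘ sym) (≢b vp-lost) (≢d vp-lost))))
            qd≡ad : K q d ≡ K a d
            qd≡ad = trans (K-sym q d)
              (proj₂ (flat T.d∈V (outer (T.a≢d ∘ sym) (≢b vq-lost) (≢d vq-lost))))
            pqa : VTri p q a
            pqa = vswap₂₃ (vswap₁₂ vpq)
            pb∉ : K p b ∉ tri p q a
            pb∉ m = lost-∉tri (ab-private P) pqa (∉₁ (≢b vp-lost ∘ sym)) (∉₁ (≢b vq-lost ∘ sym)) (∉₁ a≢b)
              (subst (_∈ tri p q a) pb≡ab m)
            conclude : ¬ (K q d ∈ K p b ∷ tri p q a)
            conclude (here e)  = ab≢ad (trans (sym pb≡ab) (trans (sym e) qd≡ad))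
            conclude (there m) = lost-∉tri (ad-private P) pqa
              (∉₁ (≢d vp-lost ∘ sym)) (∉₁ (≢d vq-lost ∘ sym)) (∉₁ a≢d) (subst (_∈ tri p q a) qd≡ad m)

          module Broom {a b d x y} (P : Paw a b d x) (y∈V : y ∈ V) (y∉ : y ∉ a ∷ b ∷ d ∷ [])
                       (by≡ax : K b y ≡ K a x) where
            open Paw P

            -- A new colour on `a z` makes another paw, for which `spread` at `b y` forces the
            -- colour of `a x`. The triangle colours are private to `b` or `d` and cannot appear on
            -- `a z`.
            az≡ax : ∀ {z} → z ∈ V → z ∉ a ∷ b ∷ d ∷ [] → K a z ≡ K a x
            az≡ax {z} z∈V z∉ with K a z ∈ℕ? tri a b d
            ... | no az∉ = repeated (spread (paw abd z∈V z∉ az∉) y∈V y∉)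
              where
              repeated : K b y ∈ K a z ∷ tri a b d → K a z ≡ K a x
              repeated (here e)  = trans (sym e) by≡ax
              repeated (there m) = contradiction (subst (_∈ tri a b d) by≡ax m) ax∉tri
            ... | yes (here e) = contradiction e
              (ab-private P a∈V z∈V (∉₁ a≢b) (∉₁ (z∉ ∘ there ∘ here)) (z∉ ∘ here ∘ sym))
            ... | yes (there (here e)) = contradiction e
              (bd-private P a∈V z∈V (∉₁ a≢b) (∉₁ (z∉ ∘ there ∘ here)) (z∉ ∘ here ∘ sym))
            ... | yes (there (there (here e))) = contradiction e
              (ad-private P a∈V z∈V (∉₁ a≢d) (∉₁ (z∉ ∘ there ∘ there ∘ here)) (z∉ ∘ here ∘ sym))

            touching : ∀ {u v} → u ∈ a ∷ b ∷ d ∷ [] → v ∈ V → u ≢ v → K u v ∈ K a x ∷ tri a b d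
            touching {u} {v} u∈ v∈V u≢v with v ∈F? (a ∷ b ∷ d ∷ [])
            ... | yes v∈ = there (tri-edge u∈ v∈ u≢v)
            touching (here refl) v∈V _ | no v∉ = here (az≡ax v∈V v∉)
            touching (there (here refl)) v∈V _ | no v∉ = spread P v∈V v∉
            touching (there (there (here refl))) v∈V _ | no v∉ with spread (mirror P) v∈V v∉′
              where
              v∉′ = v∉ ∘ swap₂₃-∈
            ... | here e  = here e
            ... | there m = there (swap₂₃-⊆ m)

            no-4-loss : ¬ Loss (a ∷ b ∷ d ∷ []) (K a x ∷ tri a b d)
            no-4-loss (_ , _ , u∈ , v∈V , u≢v , uv∉ , _) = uv∉ (touching u∈ v∈V u≢v)

            -- Some colour outside the triangle is lost with it, and `touching` leaves only that of
            -- `a x`.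
            ax-lost : Lost (a ∷ b ∷ d ∷ []) (K a x)
            ax-lost with P₃ abd (tri a b d) ℕ.≤-refl
            ... | _ , _ , u∈ , v∈V , u≢v , uv∉ , L with touching u∈ v∈V u≢v
            ... | here e  = subst (Lost (a ∷ b ∷ d ∷ [])) e L
            ... | there m = contradiction m uv∉

            -- For a triangle `x p q` at `x`, every edge leaving it also has the colour of `a x`, so
            -- that colour is lost with `x p q`. A seventh vertex `w` contradicts this, since `a w`
            -- has the same colour.
            few-vertices : ¬ (∀ R → length R ≤ 6 → ∃ λ w → w ∈ V × w ∉ R)
            few-vertices extra = far (extra (a ∷ b ∷ d ∷ x ∷ p ∷ q ∷ []) ℕ.≤-refl)
              where
              open TriangleAt (triangle-at x∈V) using (vpq; vp-lost; vq-lost; p; q)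
              module T = VTri vpq

              ax-not-private : ¬ Lost (x ∷ []) (K a x)
              ax-not-private L with extra (a ∷ b ∷ d ∷ x ∷ []) (ℕ.m≤m+n 4 2)
              ... | w , w∈V , w∉ = L a∈V w∈V (∉₁ (x∉abd ∘ here ∘ sym))
                (∉₁ (w∉ ∘ there ∘ there ∘ there ∘ here))
                (w∉ ∘ here ∘ sym)
                (az≡ax w∈V (∉₃ (w∉ ∘ here) (w∉ ∘ there ∘ here) (w∉ ∘ there ∘ there ∘ here)))

              outer : ∀ {r} → x ≢ r → Lost (x ∷ []) (K x r) → r ∉ a ∷ b ∷ d ∷ []
              -- An edge from `x` back to the triangle has the colour of `a x` or a triangle colour,
              -- and neither is private to `x`.
              outer {r} x≢r L r∈ with touching r∈ x∈V (x≢r ∘ sym)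
              ... | here e  = ax-not-private (subst (Lost (x ∷ [])) (trans (K-sym x r) e) L)
              ... | there m = lost-∉tri L abd (∉₁ (x∉abd ∘ here ∘ sym)) (∉₁ (x∉abd ∘ there ∘ here ∘ sym))
                (∉₁ (x∉abd ∘ there ∘ there ∘ here ∘ sym)) (subst (_∈ tri a b d) (K-sym r x) m)

              p∉ : p ∉ a ∷ b ∷ d ∷ []
              p∉ = outer T.a≢b vp-lost
              q∉ : q ∉ a ∷ b ∷ d ∷ []
              q∉ = outer T.a≢d vq-lost
              a∉xpq : a ∉ x ∷ p ∷ q ∷ []
              a∉xpq = ∉₃ (x∉abd ∘ here ∘ sym) (p∉ ∘ here ∘ sym) (q∉ ∘ here ∘ sym)
              ax∉xpq : K a x ∉ tri x p q
              ax∉xpq = lost-∉tri ax-lost vpq x∉abd p∉ q∉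
              pa≡ax : K p a ≡ K a x
              pa≡ax = trans (K-sym p a) (az≡ax T.b∈V p∉)

              paw-x : Paw x p q a
              paw-x = paw vpq a∈V a∉xpq (ax∉xpq ∘ subst (_∈ tri x p q) (K-sym x a))
              paw-p : Paw p x q a
              paw-p = paw (vswap₁₂ vpq) a∈V (a∉xpq ∘ swap₁₂-∈)
                (ax∉xpq ∘ swap₁₂-⊆ ∘ subst (_∈ tri p x q) pa≡ax)

              leaving : ∀ {u v} → u ∈ x ∷ p ∷ q ∷ [] → v ∈ V → v ∉ x ∷ p ∷ q ∷ [] → K u v ≡ K a x
              -- At each corner `spread′` leaves two colours. The one on a side of `x p q` is
              -- private to the side's other end, so it cannot occur on an edge that avoids that
              -- end.
              leaving (here refl) v∈V v∉ with spread′ paw-p v∈V (v∉ ∘ swap₁₂-∈)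
              ... | inj₂ e = trans e pa≡ax
              ... | inj₁ e = contradiction (trans e (K-sym p x))
                (ab-private paw-x T.a∈V v∈V (∉₁ T.a≢b) (∉₁ (v∉ ∘ there ∘ here)) (v∉ ∘ here ∘ sym))
              leaving (there (here refl)) v∈V v∉ with spread′ paw-x v∈V v∉
              ... | inj₂ e = trans e (K-sym x a)
              ... | inj₁ e = contradiction e
                (vp-lost T.b∈V v∈V (∉₁ (T.a≢b ∘ sym)) (∉₁ (v∉ ∘ here)) (v∉ ∘ there ∘ here ∘ sym))
              leaving (there (there (here refl))) v∈V v∉ with spread′ (mirror paw-x) v∈V (v∉ ∘ swap₂₃-∈)
              ... | inj₂ e = trans e (K-sym x a)
              ... | inj₁ e = contradiction e
                (vq-lost T.d∈V v∈V (∉₁ (T.a≢d ∘ sym)) (∉₁ (v∉ ∘ here)) (v∉ ∘ there ∘ there ∘ here ∘ sym))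

              ax-lost′ : Lost (x ∷ p ∷ q ∷ []) (K a x)
              ax-lost′ with P₃ vpq (tri x p q) ℕ.≤-refl
              ... | u , v , u∈ , v∈V , u≢v , uv∉ , L =
                subst (Lost (x ∷ p ∷ q ∷ [])) (leaving u∈ v∈V λ v∈ → uv∉ (tri-edge u∈ v∈ u≢v)) L

              far : ¬ (∃ λ w → w ∈ V × w ∉ a ∷ b ∷ d ∷ x ∷ p ∷ q ∷ [])
              far (w , w∈V , w∉) = ax-lost′ a∈V w∈V a∉xpq
                (w∉ ∘ there ∘ there ∘ there) (w∉ ∘ here ∘ sym)
                (az≡ax w∈V (∉₃ (w∉ ∘ here) (w∉ ∘ there ∘ here) (w∉ ∘ there ∘ there ∘ here)))

          -- The three alternatives hold for |V| = 6, |V| = 5 and |V| ≥ 7.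
          Extra : Set
          Extra = (∀ {v} → v ∈ V → ∀ E → length E ≤ 2 → Loss (v ∷ []) E)
                ⊎ (∀ {a b d} → VTri a b d → ∀ E → length E ≤ 4 → Loss (a ∷ b ∷ d ∷ []) E)
                ⊎ (∀ R → length R ≤ 6 → ∃ λ w → w ∈ V × w ∉ R)

          -- The alternatives contradict, in turn, the count of private colours at `b`, the four
          -- colours on edges meeting the triangle, and the absence of a seventh vertex.
          no-broom : Extra → ∀ {a b d x y} → Paw a b d x → y ∈ V → y ∉ a ∷ b ∷ d ∷ [] → K b y ≢ K a x
          no-broom (inj₁ P₁⁺)        P _   _  _ = two-privates-at-b P (P₁⁺ (Paw.b∈V P) _ ℕ.≤-refl)
          no-broom (inj₂ (inj₁ P₃⁺)) P y∈V y∉ e = Broom.no-4-loss P y∈V y∉ e (P₃⁺ (Paw.abd P) _ ℕ.≤-refl)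
          no-broom (inj₂ (inj₂ ext)) P y∈V y∉ e = Broom.few-vertices P y∈V y∉ e ext

          no-paw : Extra → ∀ {a b d x} → ¬ Paw a b d x
          no-paw ext {a} {b} {d} P = not-flat P λ y∈V y∉ →
            flat P y∈V y∉ , flat (mirror P) y∈V (y∉ ∘ swap₂₃-∈)
            where
            flat : ∀ {a b d x y} → Paw a b d x → y ∈ V → y ∉ a ∷ b ∷ d ∷ [] → K b y ≡ K a b
            flat P y∈V y∉ with spread′ P y∈V y∉
            ... | inj₁ e = e
            ... | inj₂ e = contradiction e (no-broom ext P y∈V y∉)

          -- A fourth colour lost with a rainbow triangle lies on an edge leaving it, which makes a
          -- paw at one of the three corners.
          impossible : Extra → ∀ {v} → v ∉ V
          impossible ext v∈V with TriangleAt.vpq (triangle-at v∈V)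
          ... | t with P₃ t _ ℕ.≤-refl
          ... | _ , w , u∈ , w∈V , u≢w , uv∉ , _ = at u∈ t (λ w∈ → uv∉ (tri-edge u∈ w∈ u≢w)) uv∉
            where
            at : ∀ {a b d u} → u ∈ a ∷ b ∷ d ∷ [] → VTri a b d → w ∉ a ∷ b ∷ d ∷ [] →
                 ¬ (K u w ∉ tri a b d)
            at (here refl) t w∉ uw∉ = no-paw ext (paw t w∈V w∉ uw∉)
            at (there (here refl)) t w∉ uw∉ =
              no-paw ext (paw (vswap₁₂ t) w∈V (w∉ ∘ swap₁₂-∈) (uw∉ ∘ swap₁₂-⊆))
            at (there (there (here refl))) t w∉ uw∉ = no-paw ext
              (paw (vswap₁₂ (vswap₂₃ t)) w∈V (w∉ ∘ swap₂₃-∈ ∘ swap₁₂-∈) (uw∉ ∘ swap₂₃-⊆ ∘ swap₁₂-⊆))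

    -- From minimality to lost colours

    AtMost : ℕ → List (Fin n) → Set
    AtMost B S = ∀ {L} → Unique L → All (Occurs S) L → length L ≤ B

    at-most-colours : ∀ S → AtMost (length (colours S)) S
    at-most-colours S uL occ = unique-⊆⇒length≤ uL (occurs⇒∈ (colours S) edge∈colours occ)

    -- L is a set of colours seen on V; sets are duplicate-free lists.
    module Deletion {V} (uV : Unique V) {L} (uL : Unique L) (occ : All (Occurs V) L) where
      open Within V

      rest : List (Fin n) → List (Fin n)
      rest R = filter (λ v → ¬? (v ∈F? R)) V

      rest-unique : ∀ R → Unique (rest R)
      rest-unique R = Unique.filter⁺ (λ v → ¬? (v ∈F? R)) uV

      rest⁻ : ∀ R {v} → v ∈ rest R → v ∈ V × v ∉ R
      rest⁻ R = ∈-filter⁻ (λ v → ¬? (v ∈F? R)) {xs = V}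

      length-rest : ∀ {R} → Unique R → R ⊆ V → length R + length (rest R) ≡ length V
      length-rest {R} uR R⊆V = trans (sym (length-++ R)) (ℕ.≤-antisym
        (unique-⊆⇒length≤ (Unique.++⁺ uR (rest-unique R) λ (v∈R , v∈rest) → proj₂ (rest⁻ R v∈rest) v∈R)
          λ v∈ → [ R⊆V , proj₁ ∘ rest⁻ R ]′ (∈-++⁻ R v∈))
        (unique-⊆⇒length≤ uV cover))
        where
        cover : V ⊆ R ++ rest R
        cover {v} v∈V with v ∈F? R
        ... | yes v∈R = ∈-++⁺ˡ v∈R
        ... | no  v∉R = ∈-++⁺ʳ R (∈-filter⁺ (λ v → ¬? (v ∈F? R)) v∈V v∉R)

      -- The colours in `E` and those surviving on `rest R` are too few to exhaust `L`. A remaining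
      -- colour still occurs on `V`, hence on an edge with an end in `R`.
      loss : ∀ R E {B} → AtMost B (rest R) → length E + B < length L → Loss R E
      loss R E {B} bound lt with pigeonhole ℕ._≟_ (E ++ L′) uL small
        where
        L′ = filter (occurs? (rest R)) L
        small : length (E ++ L′) < length L
        small = ℕ.≤-<-trans
          (ℕ.≤-trans (ℕ.≤-reflexive (length-++ E))
            (ℕ.+-monoʳ-≤ (length E) (bound (Unique.filter⁺ (occurs? (rest R)) uL)
                (all-filter (occurs? (rest R)) L))))
          lt
      ... | ℓ , ℓ∈L , ℓ∉ with occurs⁻ (All.lookup occ ℓ∈L)
      ... | u , v , u∈V , v∈V , u≢v , refl = orient (u ∈F? R) (v ∈F? R)
        where
        lost : Lost R (K u v)
        lost {x} {y} x∈V y∈V x∉R y∉R x≢y e = ℓ∉ (∈-++⁺ʳ E (∈-filter⁺ (occurs? (rest R)) ℓ∈L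
          (subst (Occurs (rest R)) e (occurs⁺ (keep x∈V x∉R) (keep y∈V y∉R) x≢y))))
          where
          keep : ∀ {v} → v ∈ V → v ∉ R → v ∈ rest R
          keep = ∈-filter⁺ (λ v → ¬? (v ∈F? R))
        orient : Dec (u ∈ R) → Dec (v ∈ R) → Loss R E
        orient (yes u∈R) _ = u , v , u∈R , v∈V , u≢v , ℓ∉ ∘ ∈-++⁺ˡ , λ {x} {y} → lost {x} {y}
        orient (no _) (yes v∈R) = v , u , v∈R , u∈V , u≢v ∘ sym
          , ℓ∉ ∘ ∈-++⁺ˡ ∘ subst (_∈ E) (K-sym v u)
          , subst (Lost R) (K-sym u v) (λ {x} {y} → lost {x} {y})
        orient (no u∉R) (no v∉R) = contradiction refl (lost u∈V v∈V u∉R v∉R u≢v)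

      module Minimal {k} (|V|≡k : length V ≡ k)
                     (ih : ∀ {S} → Unique S → length S < k → AtMost (maxColours (length S)) S)
                     (large : maxColours k < length L) where

        loss-ih : ∀ {R m} E → Unique R → R ⊆ V → length R + m ≡ k → 0 < length R →
                  length E + maxColours m ≤ maxColours k → Loss R E
        loss-ih {R} {m} E uR R⊆V eq nonempty le =
          loss R E (subst (λ m → AtMost (maxColours m) (rest R)) |rest|≡m (ih (rest-unique R) shorter))
            (ℕ.≤-<-trans le large)
          where
          |R|+|rest|≡k : length R + length (rest R) ≡ k
          |R|+|rest|≡k = trans (length-rest uR R⊆V) |V|≡k
          |rest|≡m : length (rest R) ≡ m
          |rest|≡m = ℕ.+-cancelˡ-≡ (length R) _ _ (trans |R|+|rest|≡k (sym eq))
          shorter : length (rest R) < k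
          shorter = subst (length (rest R) <_) |R|+|rest|≡k (ℕ.m<n+m (length (rest R)) nonempty)

        singleton-loss : ∀ {v m} → v ∈ V → 1 + m ≡ k → ∀ j → j + maxColours m ≤ maxColours k →
                         ∀ E → length E ≤ j → Loss (v ∷ []) E
        singleton-loss v∈V eq j le E |E|≤j = loss-ih E ([] ∷ []) (list-⊆ (v∈V ∷ [])) eq (s≤s z≤n)
          (ℕ.≤-trans (ℕ.+-monoˡ-≤ _ |E|≤j) le)

        triangle-loss : ∀ {a b d m} → VTri a b d → 3 + m ≡ k → ∀ j → j + maxColours m ≤ maxColours k →
                        ∀ E → length E ≤ j → Loss (a ∷ b ∷ d ∷ []) E
        triangle-loss t eq j le E |E|≤j = loss-ih E (vertices-unique triangle)
          (list-⊆ (a∈V ∷ b∈V ∷ d∈V ∷ [])) eq (s≤s z≤n) (ℕ.≤-trans (ℕ.+-monoˡ-≤ _ |E|≤j) le)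
          where open VTri t

        diamond-loss : ∀ {a b d e m} → VTri a b d → e ∈ V → Diamond a b d e → 4 + m ≡ k →
                       ∀ j → j + maxColours m ≤ maxColours k →
                       ∀ E → length E ≤ j → Loss (a ∷ b ∷ d ∷ e ∷ []) E
        diamond-loss t e∈V D eq j le E |E|≤j = loss-ih E
          ((a≢b ∷ a≢d ∷ (e∉abd ∘ here ∘ sym) ∷ []) ∷ (b≢d ∷ (e∉abd ∘ there ∘ here ∘ sym) ∷ []) ∷
           ((e∉abd ∘ there ∘ there ∘ here ∘ sym) ∷ []) ∷ [] ∷ [])
          (list-⊆ (a∈V ∷ b∈V ∷ d∈V ∷ e∈V ∷ [])) eq (s≤s z≤n) (ℕ.≤-trans (ℕ.+-monoˡ-≤ _ |E|≤j) le)
          where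
          open VTri t
          open Diamond D using (e∉abd)

        vertex-outside : ∀ R → length R < k → ∃ λ v → v ∈ V × v ∉ R
        vertex-outside R lt = pigeonhole Fin._≟_ R uV (subst (length R <_) (sym |V|≡k) lt)

      -- A minimal counterexample on five vertices

      module _ (|V|≡5 : length V ≡ 5)
               (ih : ∀ {S} → Unique S → length S < 5 → AtMost (maxColours (length S)) S)
               (large : 5 < length L) where
        open Minimal |V|≡5 ih large

        private
          no-diamond : ∀ {a b d e} → VTri a b d → e ∈ V → ¬ Diamond a b d e
          no-diamond {a} {b} {d} {e} t e∈V D with vertex-outside (a ∷ b ∷ d ∷ e ∷ []) ℕ.≤-refl
          ... | _ , _ , x∉ = DiamondIn.no-5-loss D t e∈V x∉
            (diamond-loss t e∈V D refl 5 ℕ.≤-refl (diamond a b d e) ℕ.≤-refl)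

          four-set : ∀ {S} → Unique S → S ⊆ V → length S ≡ 4 → AtMost 4 S
          four-set {_ ∷ _ ∷ _ ∷ _ ∷ []} uS S⊆V refl = FourSets.four-set-bound no-diamond uS S⊆V

          -- The general bound of five colours on four vertices is too weak here; absence of
          -- diamonds lowers it to four, so two colours are lost with `v`.
          P₁ : ∀ {v} → v ∈ V → ∀ E → length E ≤ 1 → Loss (v ∷ []) E
          P₁ {v} v∈V E |E|≤1 = loss (v ∷ []) E
            (four-set (rest-unique (v ∷ [])) (proj₁ ∘ rest⁻ (v ∷ []))
              (ℕ.suc-injective (trans (length-rest ([] ∷ []) (list-⊆ (v∈V ∷ []))) |V|≡5)))
            (ℕ.≤-<-trans (ℕ.+-monoˡ-≤ 4 |E|≤1) large)

        no-minimal-five : ∀ {v} → v ∉ V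
        no-minimal-five = Lossy.DiamondFree.impossible P₁
          (λ t E |E|≤3 → triangle-loss t refl 4 ℕ.≤-refl E (ℕ.m≤n⇒m≤1+n |E|≤3)) no-diamond
          (inj₂ (inj₁ λ t → triangle-loss t refl 4 ℕ.≤-refl))

      -- A minimal counterexample on six or more vertices

      module _ {m} (|V|≡6+m : length V ≡ 6 + m)
               (ih : ∀ {S} → Unique S → length S < 6 + m → AtMost (maxColours (length S)) S)
               (large : 7 + m < length L) where
        open Minimal |V|≡6+m ih large
        open Lossy (λ v∈V → singleton-loss v∈V refl 1 (gain₁ m)) (λ t → triangle-loss t refl 3 (gain₃ m))

        private
          no-diamond : ∀ {a b d e} → VTri a b d → e ∈ V → ¬ Diamond a b d e
          no-diamond {a} {b} {d} {e} t e∈V D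
            with vertex-outside (a ∷ b ∷ d ∷ e ∷ []) (ℕ.m≤n⇒m≤o+n 1 (ℕ.m≤m+n 5 m))
          ... | _ , x∈ , x∉ = diamond-no-4-loss D t e∈V x∉ x∈ (diamond-loss t e∈V D refl 4 (gain₄ m))

        no-minimal-large : ∀ {v} → v ∉ V
        no-minimal-large = DiamondFree.impossible no-diamond (extra m refl)
          where
          extra : ∀ j → j ≡ m → DiamondFree.Extra no-diamond
          extra zero    refl = inj₁ λ v∈V → singleton-loss v∈V refl 2 ℕ.≤-refl
          extra (suc j) refl = inj₂ (inj₂ λ R |R|≤6 →
            vertex-outside R (ℕ.≤-trans (s≤s |R|≤6) (ℕ.m≤m+n 7 j)))

    -- The colour bound by induction on the number of vertices

    module _ (5≤n : 5 ≤ n) where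

      -- Six colours would make all six edges distinct in colour, a rainbow K_4, which a fifth
      -- vertex of the complete graph excludes.
      four-bound : ∀ {a b d e} → Unique (a ∷ b ∷ d ∷ e ∷ []) → AtMost 5 (a ∷ b ∷ d ∷ e ∷ [])
      four-bound {a} {b} {d} {e} ((a≢b ∷ a≢d ∷ a≢e ∷ []) ∷ (b≢d ∷ b≢e ∷ []) ∷ (d≢e ∷ []) ∷ [] ∷ []) uL occ =
        ℕ.≮⇒≥ λ 5<|L| → rainbow (covering-unique ℕ._≟_ (colours (a ∷ b ∷ d ∷ e ∷ [])) uL
          (occurs⇒∈ (colours (a ∷ b ∷ d ∷ e ∷ [])) edge∈colours occ) 5<|L|)
        where
        rainbow : ¬ Unique (colours (a ∷ b ∷ d ∷ e ∷ []))
        rainbow ((ab≢ad ∷ ab≢ae ∷ ab≢bd ∷ ab≢be ∷ ab≢de ∷ []) ∷ (ad≢ae ∷ ad≢bd ∷ ad≢be ∷ ad≢de ∷ []) ∷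
                 (ae≢bd ∷ ae≢be ∷ ae≢de ∷ []) ∷ (bd≢be ∷ bd≢de ∷ []) ∷ (be≢de ∷ []) ∷ [] ∷ [])
          with pigeonhole Fin._≟_ (a ∷ b ∷ d ∷ e ∷ []) (Unique.allFin⁺ n)
                 (subst (5 ≤_) (sym (length-tabulate id)) 5≤n)
        ... | _ , _ , x∉ = de∉ (no-rainbow-K₄ D x∉)
          where
          be∉ : K b e ∉ K a e ∷ tri a b d
          be∉ (here p)  = ae≢be (sym p)
          be∉ (there p) = ∉₃ (ab≢be ∘ sym) (bd≢be ∘ sym) (ad≢be ∘ sym) p
          D : Diamond a b d e
          D = record
            { abd = record { a≢b = a≢b ; b≢d = b≢d ; a≢d = a≢d
                           ; ab≢bd = ab≢bd ; ab≢ad = ab≢ad ; bd≢ad = ad≢bd ∘ sym }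
            ; e∉abd = ∉₃ (a≢e ∘ sym) (b≢e ∘ sym) (d≢e ∘ sym)
            ; ae∉tri = ∉₃ (ab≢ae ∘ sym) ae≢bd (ad≢ae ∘ sym)
            ; be∉ae∷tri = be∉ }
          de∉ : K d e ∉ diamond a b d e
          de∉ (here p)          = be≢de (sym p)
          de∉ (there (here p))  = ae≢de (sym p)
          de∉ (there (there p)) = ∉₃ (ab≢de ∘ sym) (bd≢de ∘ sym) (ad≢de ∘ sym) p

      colour-bound : ∀ {V} → Unique V → AtMost (maxColours (length V)) V
      colour-bound uV = <-rec Bound step _ uV refl
        where
        Bound : ℕ → Set
        Bound k = ∀ {V} → Unique V → length V ≡ k → AtMost (maxColours k) V
        step : ∀ k → (∀ {j} → j < k → Bound j) → Bound k
        -- Up to three vertices the bound is the number of edges.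
        step _ _ {[]}                 _  refl = at-most-colours _
        step _ _ {_ ∷ []}             _  refl = at-most-colours _
        step _ _ {_ ∷ _ ∷ []}         _  refl = at-most-colours _
        step _ _ {_ ∷ _ ∷ _ ∷ []}     _  refl = at-most-colours _
        step _ _ {_ ∷ _ ∷ _ ∷ _ ∷ []} uV refl = four-bound uV
        step _ ih {_ ∷ _ ∷ _ ∷ _ ∷ _ ∷ []} uV refl uL occ = ℕ.≮⇒≥ λ large →
          Deletion.no-minimal-five uV uL occ refl (λ uS lt → ih lt uS refl) large (here refl)
        step _ ih {_ ∷ _ ∷ _ ∷ _ ∷ _ ∷ _ ∷ _} uV refl uL occ = ℕ.≮⇒≥ λ large →
          Deletion.no-minimal-large uV uL occ refl (λ uS lt → ih lt uS refl) large (here refl)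

  -- The colour bound assumes that there is no rainbow bull; decidability turns the resulting
  -- contradiction into an actual bull in `forces`.
  rainbowBull? : Dec (RainbowBull c)
  rainbowBull? = map′ (λ (_ , _ , _ , _ , _ , uv , uc) → bull uv uc) from
    (Fin.any? λ a → Fin.any? λ b → Fin.any? λ d → Fin.any? λ x → Fin.any? λ y →
      unique? Fin._≟_ (y ∷ x ∷ a ∷ b ∷ d ∷ []) ×-dec
      unique? ℕ._≟_ (K b y ∷ K a x ∷ K a b ∷ K b d ∷ K a d ∷ []))
    where
    order-unique : Unique {A = Fin 5} (4F ∷ 3F ∷ 0F ∷ 1F ∷ 2F ∷ [])
    order-unique = from-yes (unique? Fin._≟_ (4F ∷ 3F ∷ 0F ∷ 1F ∷ 2F ∷ []))
    from : RainbowBull c → ∃ λ a → ∃ λ b → ∃ λ d → ∃ λ x → ∃ λ y →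
           Unique (y ∷ x ∷ a ∷ b ∷ d ∷ []) × Unique (K b y ∷ K a x ∷ K a b ∷ K b d ∷ K a d ∷ [])
    from (φ , φ-injective , e-injective) = φ 0F , φ 1F , φ 2F , φ 3F , φ 4F
      , Unique.map⁺ φ-injective order-unique , Unique.map⁺ e-injective order-unique

forces : ∀ {n m} → 5 ≤ n → maxColours n < m → Forces n m
forces {n} {m} 5≤n lt c (f , f-injective) = decidable-stable (rainbowBull? c) λ free →
  ℕ.<⇒≱ lt (ℕ.≤-trans (ℕ.≤-reflexive (sym (length-tabulate (edgeColour c ∘ f))))
    (subst (λ k → BullFree.AtMost c free (maxColours k) (allFin n)) (length-tabulate {n = n} id)
      (BullFree.colour-bound c free 5≤n (Unique.allFin⁺ n)) (Unique.tabulate⁺ f-injective)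
      (tabulate⁺ λ k → occurs⁺ c (∈-allFin _) (∈-allFin _) (Fin.<⇒≢ (proj₂ (f k))))))

-- Colourings without rainbow bull

-- A permutation whose cycles have length at most 4; `closes` alone makes `next` injective.
record Rotation (n : ℕ) : Set where
  field
    next   : Fin n → Fin n
    closes : ∀ i → next (next (next i)) ≡ i ⊎ next (next (next (next i))) ≡ i

  private
    mixed : ∀ {i j} → next (next (next i)) ≡ i → next (next (next (next j))) ≡ j →
            next i ≡ next j → i ≡ j
    -- Four steps from `i` and from `j` agree, the former being `next i` and the latter `j`. So
    -- `next i` is `j`, which is then a fixed point.
    mixed {i} {j} p q e = trans (sym p) (trans (cong (next ∘ next) i→j) (trans (cong next j→j) j→j))
      where
      i→j : next i ≡ j
      i→j = trans (cong next (sym p)) (trans (cong (next ∘ next ∘ next) e) q)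
      j→j : next j ≡ j
      j→j = trans (sym e) i→j

  next-injective : ∀ {i j} → next i ≡ next j → i ≡ j
  next-injective {i} {j} e with closes i | closes j
  ... | inj₁ p | inj₁ q = trans (sym p) (trans (cong (next ∘ next) e) q)
  ... | inj₂ p | inj₂ q = trans (sym p) (trans (cong (next ∘ next ∘ next) e) q)
  ... | inj₁ p | inj₂ q = mixed p q e
  ... | inj₂ p | inj₁ q = sym (mixed q p (sym e))

  -- Colour 0 is reserved for the edges off the cycles, hence the successor.
  arc : Fin n → Fin n → ℕ
  arc i j with next i Fin.≟ j
  ... | yes _ = suc (toℕ i)
  ... | no _  = 0

  arc-next : ∀ {i j} → next i ≡ j → arc i j ≡ suc (toℕ i)
  arc-next {i} {j} e with next i Fin.≟ j
  ... | yes _ = refl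
  ... | no ne = contradiction e ne

  arc-other : ∀ {i j} → next i ≢ j → arc i j ≡ 0
  arc-other {i} {j} ne with next i Fin.≟ j
  ... | yes e = contradiction e ne
  ... | no _  = refl

  -- At most one summand is nonzero unless the edge lies in a 2-cycle of next.
  cycleColouring : Colouring n
  cycleColouring = record
    { col  = λ i j → arc i j + arc j i
    ; symm = λ i j → ℕ.+-comm (arc i j) (arc j i)
    }

  private
    K = col cycleColouring

  Adj : Fin n → Fin n → Set
  Adj i j = next i ≡ j ⊎ next j ≡ i

  zero-or-adj : ∀ i j → K i j ≡ 0 ⊎ Adj i j
  zero-or-adj i j with next i Fin.≟ j | next j Fin.≟ i
  ... | yes e | _     = inj₂ (inj₁ e)
  ... | no _  | yes e = inj₂ (inj₂ e)
  ... | no _  | no _  = inj₁ refl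

  adj-sym : ∀ {i j} → Adj i j → Adj j i
  adj-sym (inj₁ e) = inj₂ e
  adj-sym (inj₂ e) = inj₁ e

  two-neighbours : ∀ {a x y z} → x ≢ y → y ≢ z → x ≢ z → Adj a x → Adj a y → ¬ Adj a z
  two-neighbours x≢y _ _ (inj₁ p) (inj₁ q) _ = x≢y (trans (sym p) q)
  two-neighbours _ y≢z _ (inj₁ _) (inj₂ q) (inj₂ r) = y≢z (next-injective (trans q (sym r)))
  two-neighbours _ _ x≢z (inj₁ p) (inj₂ _) (inj₁ r) = x≢z (trans (sym p) r)
  two-neighbours x≢y _ _ (inj₂ p) (inj₂ q) _ = x≢y (next-injective (trans p (sym q)))
  two-neighbours _ y≢z _ (inj₂ _) (inj₁ q) (inj₁ r) = y≢z (trans (sym q) r)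
  two-neighbours _ _ x≢z (inj₂ p) (inj₁ _) (inj₂ r) = x≢z (next-injective (trans p (sym r)))

  onward : ∀ {a b d} → next a ≡ b → Adj b d → a ≢ d → next b ≡ d
  onward _ (inj₁ q) _   = q
  onward p (inj₂ q) a≢d = contradiction (next-injective (trans p (sym q))) a≢d

  back : ∀ {a b d} → next b ≡ a → Adj b d → a ≢ d → next d ≡ b
  back p (inj₁ q) a≢d = contradiction (trans (sym p) q) a≢d
  back p (inj₂ q) _   = q

  -- A path that never turns back keeps following `next`, so `y` and `z` are three and four steps
  -- from `v`; one of them is `v` itself.
  no-directed-path : ∀ {v w x y z} → v ≢ x → w ≢ y → x ≢ z → v ≢ y → v ≢ z →
                     next v ≡ w → Adj w x → Adj x y → ¬ Adj y z
  no-directed-path {v} v≢x w≢y x≢z v≢y v≢z refl wx xy yz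
    with refl ← onward refl wx v≢x with refl ← onward refl xy w≢y with refl ← onward refl yz x≢z
    with closes v
  ... | inj₁ e = v≢y (sym e)
  ... | inj₂ e = v≢z (sym e)

  no-path : ∀ {v w x y z} → v ≢ x → w ≢ y → x ≢ z → v ≢ y → w ≢ z → v ≢ z →
            Adj v w → Adj w x → Adj x y → ¬ Adj y z
  no-path v≢x w≢y x≢z v≢y w≢z v≢z (inj₁ e) wx xy yz = no-directed-path v≢x w≢y x≢z v≢y v≢z e wx xy yz
  no-path v≢x w≢y x≢z v≢y w≢z v≢z (inj₂ e) wx xy yz =
    no-directed-path (x≢z ∘ sym) (w≢y ∘ sym) (v≢x ∘ sym) (w≢z ∘ sym) (v≢z ∘ sym)
      (back (back (back e wx v≢x) xy w≢y) yz x≢z) (adj-sym xy) (adj-sym wx) (inj₁ e)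

  no-rainbow-bull : ¬ RainbowBull cycleColouring
  no-rainbow-bull (φ , φ-injective , e-injective) = go (edge 0F)
    where
    u w : Fin 5 → Fin n
    u = φ ∘ proj₁ ∘ bullEdge
    w = φ ∘ proj₂ ∘ bullEdge
    edge : ∀ e → K (u e) (w e) ≡ 0 ⊎ Adj (u e) (w e)
    edge e = zero-or-adj (u e) (w e)
    apart : ∀ {i j} → i ≢ j → φ i ≢ φ j
    apart i≢j = i≢j ∘ φ-injective
    one-zero : ∀ {e f} → e ≢ f → K (u e) (w e) ≡ 0 → K (u f) (w f) ≢ 0
    one-zero e≢f p q = e≢f (e-injective (trans p (sym q)))
    adj : ∀ {e} → K (u 0F) (w 0F) ≡ 0 → 0F ≢ e → Adj (u e) (w e)
    adj {e} p ne with edge e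
    ... | inj₁ q = contradiction q (one-zero ne p)
    ... | inj₂ a = a
    go : ¬ (K (u 0F) (w 0F) ≡ 0 ⊎ Adj (u 0F) (w 0F))
    -- If the edge joining the two vertices of degree 3 has colour 0, the other four edges are cycle
    -- edges and form a path on five vertices.
    go (inj₁ p) = no-path (apart λ ()) (apart λ ()) (apart λ ()) (apart λ ()) (apart λ ()) (apart λ ())
      (adj-sym (adj {3F} p λ ())) (adj {2F} p λ ()) (adj-sym (adj {1F} p λ ())) (adj {4F} p λ ())
    -- If it is a cycle edge, each of its ends has at most one further cycle edge, so each end lies
    -- on another edge of colour 0. These two edges are distinct.
    go (inj₂ a) with edge 2F | edge 3F | edge 1F | edge 4F
    ... | inj₂ b | inj₂ d | _      | _      = two-neighbours (apart λ ()) (apart λ ()) (apart λ ()) a b d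
    ... | _      | _      | inj₂ b | inj₂ d =
      two-neighbours (apart λ ()) (apart λ ()) (apart λ ()) (adj-sym a) b d
    ... | inj₁ p | _      | inj₁ q | _      = one-zero {2F} {1F} (λ ()) p q
    ... | inj₁ p | _      | _      | inj₁ q = one-zero {2F} {4F} (λ ()) p q
    ... | _      | inj₁ p | inj₁ q | _      = one-zero {3F} {1F} (λ ()) p q
    ... | _      | inj₁ p | _      | inj₁ q = one-zero {3F} {4F} (λ ()) p q

  zero-pair : 5 ≤ n → (i : Fin n) → ∃ λ j → i ≢ j × K i j ≡ 0
  -- The predecessor of `i` is two or three steps after it, so excluding `i` and its next three
  -- iterates excludes both neighbours.
  zero-pair 5≤n i with pigeonhole Fin._≟_ (i ∷ next i ∷ next (next i) ∷ next (next (next i)) ∷ [])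
    (Unique.allFin⁺ n) (subst (5 ≤_) (sym (length-tabulate id)) 5≤n)
  ... | j , _ , j∉ = j , j∉ ∘ here ∘ sym
    , cong₂ _+_ (arc-other (j∉ ∘ there ∘ here ∘ sym)) (arc-other j↛i)
    where
    j↛i : next j ≢ i
    j↛i refl with closes j
    ... | inj₁ e = j∉ (there (there (here (sym e))))
    ... | inj₂ e = j∉ (there (there (there (here (sym e)))))

  toEdge : ∀ {i j} → i ≢ j → Σ (Edge n) λ e → edgeColour cycleColouring e ≡ K i j
  toEdge {i} {j} i≢j with Fin.<-cmp i j
  ... | tri< i<j _ _ = ((i , j) , i<j) , refl
  ... | tri≈ _ i≡j _ = contradiction i≡j i≢j
  ... | tri> _ _ j<i = ((j , i) , j<i) , ℕ.+-comm (arc j i) (arc i j)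

  -- Each vertex chosen by `ι` contributes the colour of its outgoing arc, and colour 0 is one more.
  -- The last hypothesis rules out fixed points and 2-cycles, on which that arc would not be an edge
  -- with its own colour.
  uses : 5 ≤ n → Fin n → ∀ {m} (ι : Fin m → Fin n) → Injective _≡_ _≡_ ι →
         (∀ k → next (next (ι k)) ≢ ι k) → UsesAtLeast (suc m) cycleColouring
  uses 5≤n i₀ {m} ι ι-injective moving = proj₁ ∘ f , f-injective
    where
    colour : Fin (suc m) → ℕ
    colour zero    = 0
    colour (suc k) = suc (toℕ (ι k))
    f : ∀ k → Σ (Edge n) λ e → edgeColour cycleColouring e ≡ colour k
    f zero with zero-pair 5≤n i₀
    ... | _ , i≢j , e with toEdge i≢j
    ... | edge , e′ = edge , trans e′ e
    f (suc k) with toEdge {ι k} {next (ι k)} (λ e → moving k (trans (cong next (sym e)) (sym e)))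
    ... | edge , e′ = edge , trans e′
      (trans (cong₂ _+_ (arc-next refl) (arc-other (moving k))) (ℕ.+-identityʳ _))
    colour-injective : ∀ {k l} → colour k ≡ colour l → k ≡ l
    colour-injective {zero}  {zero}  _ = refl
    colour-injective {suc k} {suc l} e = cong suc (ι-injective (Fin.toℕ-injective (ℕ.suc-injective e)))
    f-injective : Injective _≡_ _≡_ (λ k → edgeColour cycleColouring (proj₁ (f k)))
    f-injective {k} {l} e = colour-injective (trans (sym (proj₂ (f k))) (trans e (proj₂ (f l))))

-- Rotations composed of triangles and squares

open Rotation using (next; closes)

infixr 5 _⊕_
_⊕_ : ∀ {m n} → Rotation m → Rotation n → Rotation (m + n)
_⊕_ {m} {n} r s = record { next = step ; closes = λ i →
    subst Closes (Fin.join-splitAt m n i) (step-closes (splitAt m i)) }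
  where
  step : Fin (m + n) → Fin (m + n)
  step i = join m n (Sum.map (next r) (next s) (splitAt m i))
  step-join : ∀ x → step (join m n x) ≡ join m n (Sum.map (next r) (next s) x)
  step-join x = cong (join m n ∘ Sum.map (next r) (next s)) (Fin.splitAt-join m n x)
  Closes : Fin (m + n) → Set
  Closes i = step (step (step i)) ≡ i ⊎ step (step (step (step i))) ≡ i
  step-closes : ∀ x → Closes (join m n x)
  step-closes (inj₁ i) rewrite step-join (inj₁ i) | step-join (inj₁ (next r i))
    | step-join (inj₁ (next r (next r i))) | step-join (inj₁ (next r (next r (next r i)))) =
    Sum.map (cong (_↑ˡ n)) (cong (_↑ˡ n)) (closes r i)
  step-closes (inj₂ i) rewrite step-join (inj₂ i) | step-join (inj₂ (next s i))
    | step-join (inj₂ (next s (next s i))) | step-join (inj₂ (next s (next s (next s i)))) =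
    Sum.map (cong (m ↑ʳ_)) (cong (m ↑ʳ_)) (closes s i)

Moving : ∀ {n} → Rotation n → Set
Moving r = ∀ i → next r (next r i) ≢ i

⊕-moving : ∀ {m n} {r : Rotation m} {s : Rotation n} → Moving r → Moving s → Moving (r ⊕ s)
⊕-moving {m} {n} {r} {s} mr ms i e =
  moved (splitAt m i) (trans (sym (Fin.splitAt-join m n _)) (cong (splitAt m) e′))
  where
  f = Sum.map (next r) (next s)
  e′ : join m n (f (f (splitAt m i))) ≡ i
  e′ = trans (cong (join m n ∘ f) (sym (Fin.splitAt-join m n (f (splitAt m i))))) e
  moved : ∀ x → f (f x) ≢ x
  moved (inj₁ i) e = mr i (inj₁-injective e)
  moved (inj₂ i) e = ms i (inj₂-injective e)

fixed : Rotation 1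
fixed = record { next = id ; closes = λ _ → inj₁ refl }

triangle : Rotation 3
triangle = record { next = λ { 0F → 1F ; 1F → 2F ; 2F → 0F }
                  ; closes = λ { 0F → inj₁ refl ; 1F → inj₁ refl ; 2F → inj₁ refl } }

triangle-moving : Moving triangle
triangle-moving 0F ()
triangle-moving 1F ()
triangle-moving 2F ()

square : Rotation 4
square = record { next = λ { 0F → 1F ; 1F → 2F ; 2F → 3F ; 3F → 0F }
                ; closes = λ { 0F → inj₂ refl ; 1F → inj₂ refl ; 2F → inj₂ refl ; 3F → inj₂ refl } }

square-moving : Moving square
square-moving 0F ()
square-moving 1F ()
square-moving 2F ()
square-moving 3F ()

-- Every number from 6 on is a sum of threes and fours: 3+3, 3+4 and 4+4 start the three residue
-- classes modulo 3.
rotation : ∀ m → Σ (Rotation (6 + m)) Moving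
rotation 0 = triangle ⊕ triangle , ⊕-moving {r = triangle} {triangle} triangle-moving triangle-moving
rotation 1 = triangle ⊕ square , ⊕-moving {r = triangle} {square} triangle-moving square-moving
rotation 2 = square ⊕ square , ⊕-moving {r = square} {square} square-moving square-moving
rotation (suc (suc (suc m))) with rotation m
... | r , moving = triangle ⊕ r , ⊕-moving {r = triangle} {r} triangle-moving moving

-- The rainbow numbers

forces-lower : ∀ {n m} (c : Colouring n) → UsesAtLeast m c → ¬ RainbowBull c → ∀ k → Forces n k → m < k
forces-lower c (f , f-injective) free k force = ℕ.≰⇒> λ k≤m →
  free (force c (f ∘ (λ i → inject≤ i k≤m) , Fin.inject≤-injective k≤m k≤m _ _ ∘ f-injective))

rb-five : RbBull≡ 5 6
rb-five = forces ℕ.≤-refl ℕ.≤-refl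
        , forces-lower cycleColouring
            -- Only the four vertices of the square carry cycle colours; with colour 0 this gives
            -- five.
            (uses ℕ.≤-refl 0F (_↑ˡ 1) (Fin.↑ˡ-injective 1 _ _) moving) no-rainbow-bull
  where
  open Rotation (square ⊕ fixed)
  moving : ∀ (k : Fin 4) → next (square ⊕ fixed) (next (square ⊕ fixed) (k ↑ˡ 1)) ≢ k ↑ˡ 1
  moving 0F ()
  moving 1F ()
  moving 2F ()
  moving 3F ()

rb-large : ∀ m → RbBull≡ (6 + m) (8 + m)
rb-large m = forces (ℕ.m≤m+n 5 (suc m)) ℕ.≤-refl
           , forces-lower cycleColouring
               (uses (ℕ.m≤m+n 5 (suc m)) 0F id id (proj₂ (rotation m))) no-rainbow-bull
  where open Rotation (proj₁ (rotation m))

theorem6 : RbBull≡ 5 6 × ((n : ℕ) → 6 ≤ n → RbBull≡ n (n + 2))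
theorem6 = rb-five , large
  where
  large : (n : ℕ) → 6 ≤ n → RbBull≡ n (n + 2)
  large n 6≤n with ℕ.m≤n⇒∃[o]m+o≡n 6≤n
  ... | m , refl = subst (RbBull≡ (6 + m)) (cong (6 +_) (ℕ.+-comm 2 m)) (rb-large m)
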